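{- For every rational number $p/q \in [9/10, 1)$ there exist infinitely many cyclically $4$-connected cubic graphs $G$ of girth $5$ such that $m_3(G) = p/q$.
   Context: For a bridgeless cubic graph $G$, $m_3(G)$ denotes the maximum number of edges of $G$ contained in the union of three perfect matchings of $G$, divided by $|E(G)|$. An edge cut of a graph is cycle-separating if at least two of the components obtained by deleting it contain a cycle; a graph is cyclically $k$-connected if every cycle-separating edge cut has at least $k$ edges. -}

module Defs where

open import Data.Nat using (ℕ; zero; suc; _+_; _*_; _≤_; _<ᵇ_; _≡ᵇ_)
open import Data.Bool using (Bool; true; false; _∧_; _∨_; not; if_then_else_)
open import Data.Fin using (Fin; toℕ)
open import Data.List using (List; []; _∷_; _++_; length; map; allFin)
open import Data.Nat.ListAction using (sum)
open import Data.List.Relation.Unary.Unique.Propositional using (Unique)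
open import Data.List.Membership.Propositional using (_∈_)
open import Data.Product using (Σ; _×_; ∃-syntax)
open import Data.Unit using (⊤)
open import Data.Empty using (⊥)
open import Relation.Nullary using (¬_)
open import Relation.Binary.PropositionalEquality using (_≡_)

record Graph : Set where
  field
    n      : ℕ
    adj    : Fin n → Fin n → Bool
    sym    : ∀ i j → adj i j ≡ adj j i
    irrefl : ∀ i → adj i i ≡ false

Rel : ℕ → Set
Rel n = Fin n → Fin n → Bool

deg : ∀ {n} → Rel n → Fin n → ℕ
deg {n} A i = sum (map (λ j → if A i j then 1 else 0) (allFin n))

countEdges : ∀ {n} → Rel n → ℕ
countEdges {n} A =
  sum (map (λ i → sum (map (λ j → if (toℕ i <ᵇ toℕ j) ∧ A i j then 1 else 0)
                             (allFin n)))
           (allFin n))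

module _ (G : Graph) where
  open Graph G

  EdgeSet : Rel n → Set
  EdgeSet F = (∀ i j → F i j ≡ F j i) × (∀ i j → F i j ≡ true → adj i j ≡ true)

  deleteEdges : Rel n → Rel n
  deleteEdges F i j = adj i j ∧ not (F i j)

  Cubic : Set
  Cubic = ∀ i → deg adj i ≡ 3

  PerfectMatching : Rel n → Set
  PerfectMatching M = EdgeSet M × (∀ i → deg M i ≡ 1)

  union3 : Rel n → Rel n → Rel n → Rel n
  union3 M₁ M₂ M₃ i j = M₁ i j ∨ M₂ i j ∨ M₃ i j

_=ᶠ_ : ∀ {n} → Fin n → Fin n → Bool
i =ᶠ j = toℕ i ≡ᵇ toℕ j

Chain : ∀ {n} → Rel n → Fin n → List (Fin n) → Set
Chain A x []       = ⊤
Chain A x (y ∷ ys) = (A x y ≡ true) × Chain A y ys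

IsCycle : ∀ {n} → Rel n → List (Fin n) → Set
IsCycle A []       = ⊥
IsCycle A (x ∷ xs) = Unique (x ∷ xs) × 3 ≤ length (x ∷ xs) × Chain A x (xs ++ x ∷ [])

data Reach {n} (A : Rel n) : Fin n → Fin n → Set where
  here  : ∀ {u} → Reach A u u
  step  : ∀ {u w v} → A u w ≡ true → Reach A w v → Reach A u v

module _ (G : Graph) where
  open Graph G

  Bridgeless : Set
  Bridgeless = ∀ u v → adj u v ≡ true →
    Reach (λ i j → adj i j ∧ not ((i =ᶠ u ∧ j =ᶠ v) ∨ (i =ᶠ v ∧ j =ᶠ u))) u v

  HasGirth : ℕ → Set
  HasGirth g = (Σ (List (Fin n)) λ c → IsCycle adj c × length c ≡ g)
             × (∀ c → IsCycle adj c → g ≤ length c)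

  CycleSeparating : Rel n → Set
  CycleSeparating F = Σ (List (Fin n)) λ c₁ → Σ (List (Fin n)) λ c₂ →
    IsCycle (deleteEdges G F) c₁ × IsCycle (deleteEdges G F) c₂ ×
    Σ (Fin n) λ u → Σ (Fin n) λ v → u ∈ c₁ × v ∈ c₂ × ¬ Reach (deleteEdges G F) u v

  CyclicallyConnected : ℕ → Set
  CyclicallyConnected k = ∀ F → EdgeSet G F → CycleSeparating F → k ≤ countEdges F

  M3Equals : ℕ → ℕ → Set
  M3Equals p q =
    (Σ (Rel n) λ M₁ → Σ (Rel n) λ M₂ → Σ (Rel n) λ M₃ →
       PerfectMatching G M₁ × PerfectMatching G M₂ × PerfectMatching G M₃ ×
       countEdges (union3 G M₁ M₂ M₃) * q ≡ p * countEdges adj)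
    × (∀ M₁ M₂ M₃ → PerfectMatching G M₁ → PerfectMatching G M₂ → PerfectMatching G M₃ →
       countEdges (union3 G M₁ M₂ M₃) * q ≤ p * countEdges adj)

{-# OPTIONS --safe #-}
module Submission where

-- The graph is a closed ring of 10-vertex blocks, consecutive blocks being joined by two edges.
-- A plain block is the Petersen graph minus two independent edges; in a 3-edge-colouring the two
-- edges leaving it on one side get different colours. A twisted block is the Petersen graph minus
-- two adjacent vertices with a rung added on one side; there they get equal colours. So if every
-- neighbour of a twisted block is plain, each twisted block forces a defect. With the deficit of a
-- vertex (for three perfect matchings) defined as the number of uncovered edges at it, a
-- discharging argument shows that the total deficit is at least 6 per twisted block, i.e. three
-- uncovered edges each, and this is attained. Twisted blocks occupy any number a ≤ k of the even
-- positions in a ring of 2k blocks, so m₃ = 1 − 3a/30k takes every rational value in [9/10, 1).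
--
-- For cyclic connectivity, a set of vertices that splits a block cuts at least two inner edges of
-- it, so an edge cut of size at most 3 is confined to one block up to the two junctions next to
-- it, and there only trivial cuts are that small.

open import Defs
open import Data.Nat using (ℕ; zero; suc; pred; _+_; _*_; _≤_; _<_; _<ᵇ_; z≤n; s≤s; _≤?_)
open import Data.Nat.Properties hiding (_≟_)
import Data.Nat.Properties as ℕ
import Data.Nat.ListAction as ListAction
open import Data.Nat.Tactic.RingSolver using (solve-∀)
open import Data.Bool using (Bool; true; false; _∧_; _∨_; not; if_then_else_; _xor_; T)
import Data.Bool.Properties as Bool
open import Data.Fin using (Fin; zero; suc; toℕ; fromℕ; inject₁; #_; _≟_; _↑ˡ_; _↑ʳ_; combine; remQuot)
open import Data.Fin.Patterns using (0F; 1F; 2F; 3F; 4F; 6F; 7F; 8F; 9F)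
open import Data.Fin.Properties using (all?; any?; toℕ-injective; toℕ-inject₁; toℕ-fromℕ; remQuot-combine; combine-remQuot; combine-injective)
open import Data.Fin.Induction using (<-weakInduction; >-weakInduction)
open import Data.Fin.Permutation using (permutation)
open import Data.Fin.Relation.Unary.Top using (‵fromℕ; ‵inject₁; view; view-fromℕ; view-inject₁)
open import Data.List as List using (List; []; _∷_; length; map; filter; cartesianProductWith; allFin)
open import Data.List.Properties using (map-tabulate)
open import Data.List.Membership.Propositional using (_∈_)
open import Data.List.Membership.Propositional.Properties using (∈-filter⁺; ∈-cartesianProductWith⁺; ∈-allFin)
open import Data.List.Relation.Unary.All as All using (All; []; _∷_)
import Data.List.Relation.Unary.All.Properties as All
open import Data.List.Relation.Unary.AllPairs using (_∷_)
open import Data.List.Relation.Unary.Any using (here)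
open import Data.List.Relation.Unary.Unique.DecPropositional using (unique?)
import Data.List.Relation.Unary.Unique.Propositional.Properties as Unique
open import Data.Vec using (Vec; []; _∷_; lookup; replicate; tabulate)
open import Data.Vec.Properties using (lookup∘tabulate)
open import Data.Product using (Σ; ∃-syntax; _×_; _,_; proj₁; proj₂; uncurry)
open import Data.Product.Properties using (≡-dec)
open import Data.Sum as Sum using (_⊎_; inj₁; inj₂)
open import Data.Empty using (⊥; ⊥-elim)
open import Data.Unit using (⊤; tt)
open import Function using (_∘_; id)
open import Relation.Nullary using (Dec; yes; no; ¬_; does; contradiction)
open import Relation.Nullary.Decidable using (map′; toSum; dec-true; dec-false; ¬?; _×-dec_; _⊎-dec_; _→-dec_)
open import Relation.Binary.Definitions using (tri<; tri≈; tri>)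
open import Relation.Binary.PropositionalEquality hiding (J)
open import Algebra.Properties.Semiring.Sum +-*-semiring renaming (sum-cong-≗ to sum-cong)

𝟙 : Bool → ℕ
𝟙 b = if b then 1 else 0

decided : ∀ {A : Set} (A? : Dec A) → does A? ≡ true → A
decided (yes a) _ = a

-- Sums over Fin n

sum-allFin : ∀ {n} (f : Fin n → ℕ) → ListAction.sum (map f (allFin n)) ≡ sum f
sum-allFin {n} f = trans (cong ListAction.sum (map-tabulate {n = n} id f)) (sum-tabulate f)
  where
  sum-tabulate : ∀ {n} (f : Fin n → ℕ) → ListAction.sum (List.tabulate f) ≡ sum f
  sum-tabulate {zero}  f = refl
  sum-tabulate {suc n} f = cong (f zero +_) (sum-tabulate (f ∘ suc))

sum-mono : ∀ {n} {f g : Fin n → ℕ} → (∀ i → f i ≤ g i) → sum f ≤ sum g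
sum-mono {zero}  h = z≤n
sum-mono {suc n} h = +-mono-≤ (h zero) (sum-mono (h ∘ suc))

sum-const : ∀ n k → ∑[ i < n ] k ≡ n * k
sum-const zero    k = refl
sum-const (suc n) k = cong (k +_) (sum-const n k)

δ : ∀ {n} → Fin n → Fin n → ℕ
δ i j = 𝟙 (does (i ≟ j))

δ-refl : ∀ {n} (i : Fin n) → δ i i ≡ 1
δ-refl i = cong 𝟙 (dec-true (i ≟ i) refl)

δ-distinct : ∀ {n} {i j : Fin n} → i ≢ j → δ i j ≡ 0
δ-distinct {i = i} {j} i≢j = cong 𝟙 (dec-false (i ≟ j) i≢j)

sum-zero : ∀ {n} {f : Fin n → ℕ} → (∀ i → f i ≡ 0) → sum f ≡ 0
sum-zero {n} h = trans (sum-cong h) (sum-replicate-zero n)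

sum-δ : ∀ {n} (i : Fin n) (f : Fin n → ℕ) → ∑[ j < n ] (δ i j * f j) ≡ f i
sum-δ {suc n} zero    f = trans (cong₂ _+_ (*-identityˡ (f zero)) (sum-zero {n} (λ _ → refl))) (+-identityʳ (f zero))
sum-δ {suc n} (suc i) f = trans (sum-cong λ j → cong (_* f (suc j)) (δ-suc i j)) (sum-δ i (f ∘ suc))
  where
  δ-suc : ∀ {n} (i j : Fin n) → δ (suc i) (suc j) ≡ δ i j
  δ-suc i j with i ≟ j
  ... | yes _ = refl
  ... | no  _ = refl

-- Each `w` in the support is hit by exactly one `c`, so `f w` is the sum over `c` of
-- `δ (g c) w * f w`; exchanging the sums leaves `f (g c)`. This turns sums over all vertices into
-- sums over three slots.
sum-supported : ∀ {k n} (g : Fin k → Fin n) → (∀ c d → g c ≡ g d → c ≡ d) →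
  (f : Fin n → ℕ) → (∀ w → (∃[ c ] g c ≡ w) ⊎ f w ≡ 0) → sum f ≡ sum (f ∘ g)
sum-supported {k} {n} g inj f supp = begin
  ∑[ w < n ] f w                          ≡⟨ sum-cong expand ⟩
  ∑[ w < n ] ∑[ c < k ] (δ (g c) w * f w) ≡⟨ ∑-comm (λ w c → δ (g c) w * f w) ⟩
  ∑[ c < k ] ∑[ w < n ] (δ (g c) w * f w) ≡⟨ sum-cong (λ c → sum-δ (g c) f) ⟩
  ∑[ c < k ] f (g c)                      ∎
  where
  open ≡-Reasoning
  δ-inj : ∀ c₀ c → δ (g c) (g c₀) ≡ δ c₀ c
  δ-inj c₀ c with c₀ ≟ c
  ... | yes refl = δ-refl (g c)
  ... | no  c₀≢c = δ-distinct λ e → c₀≢c (sym (inj c c₀ e))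
  expand : ∀ w → f w ≡ ∑[ c < k ] (δ (g c) w * f w)
  expand w with supp w
  ... | inj₂ f≡0 = trans f≡0 (sym (sum-zero λ c → trans (cong (δ (g c) w *_) f≡0) (*-zeroʳ (δ (g c) w))))
  ... | inj₁ (c₀ , refl) =
    sym (trans (sum-cong λ c → cong (_* f (g c₀)) (δ-inj c₀ c)) (sum-δ c₀ (λ _ → f (g c₀))))

two-terms≤sum : ∀ {n} (f : Fin n → ℕ) {i j} → i ≢ j → f i + f j ≤ sum f
two-terms≤sum {n} f {i} {j} i≢j = begin
  f i + f j                                            ≡⟨ cong₂ _+_ (sum-δ i f) (sum-δ j f) ⟨
  ∑[ k < n ] (δ i k * f k) + ∑[ k < n ] (δ j k * f k)  ≡⟨ ∑-distrib-+ (λ k → δ i k * f k) _ ⟨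
  ∑[ k < n ] (δ i k * f k + δ j k * f k)               ≤⟨ sum-mono bound ⟩
  sum f                                                ∎
  where
  open ≤-Reasoning
  bound : ∀ k → δ i k * f k + δ j k * f k ≤ f k
  bound k with i ≟ k | j ≟ k
  ... | yes refl | yes refl = contradiction refl i≢j
  ... | yes _    | no _     = ≤-reflexive (trans (+-identityʳ _) (*-identityˡ (f k)))
  ... | no _     | yes _    = ≤-reflexive (*-identityˡ (f k))
  ... | no _     | no _     = z≤n

deg-sum : ∀ {n} (F : Rel n) i → deg F i ≡ ∑[ j < n ] 𝟙 (F i j)
deg-sum F i = sum-allFin (λ j → 𝟙 (F i j))

-- `countEdges` runs over the pairs i < j. By symmetry its transpose runs over j < i, and the
-- diagonal contributes nothing.
handshake : ∀ {n} (F : Rel n) → (∀ i j → F i j ≡ F j i) → (∀ i → F i i ≡ false) →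
  2 * countEdges F ≡ sum (deg F)
handshake {n} F F-sym F-irr = begin
  2 * countEdges F
    ≡⟨ cong (2 *_) (trans (sum-allFin λ i → ListAction.sum (map (up i) (allFin n)))
         (sum-cong λ i → sum-allFin (up i))) ⟩
  2 * ∑[ i < n ] ∑[ j < n ] up i j
    ≡⟨ cong (∑[ i < n ] ∑[ j < n ] up i j +_) (+-identityʳ _) ⟩
  ∑[ i < n ] ∑[ j < n ] up i j + ∑[ i < n ] ∑[ j < n ] up i j
    ≡⟨ cong (∑[ i < n ] ∑[ j < n ] up i j +_) (∑-comm up) ⟩
  ∑[ i < n ] ∑[ j < n ] up i j + ∑[ i < n ] ∑[ j < n ] up j i
    ≡⟨ ∑-distrib-+ (λ i → ∑[ j < n ] up i j) _ ⟨
  ∑[ i < n ] (∑[ j < n ] up i j + ∑[ j < n ] up j i)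
    ≡⟨ sum-cong (λ i → trans (sym (∑-distrib-+ (up i) _)) (trans (sum-cong (split i)) (sym (deg-sum F i)))) ⟩
  ∑[ i < n ] deg F i ∎
  where
  open ≡-Reasoning
  up : Fin n → Fin n → ℕ
  up i j = 𝟙 ((toℕ i <ᵇ toℕ j) ∧ F i j)
  <ᵇ-true : ∀ {a b} → a < b → (a <ᵇ b) ≡ true
  <ᵇ-true {a} {b} h with a <ᵇ b | <⇒<ᵇ h
  ... | true | _ = refl
  <ᵇ-false : ∀ {a b} → ¬ a < b → (a <ᵇ b) ≡ false
  <ᵇ-false {a} {b} h with a <ᵇ b in eq
  ... | true  = contradiction (<ᵇ⇒< a b (subst T (sym eq) tt)) h
  ... | false = refl
  split : ∀ i j → up i j + up j i ≡ 𝟙 (F i j)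
  split i j with <-cmp (toℕ i) (toℕ j)
  ... | tri< a _ b rewrite <ᵇ-true a | <ᵇ-false b = +-identityʳ _
  ... | tri> a _ b rewrite <ᵇ-true b | <ᵇ-false a = cong 𝟙 (F-sym j i)
  ... | tri≈ a e b with toℕ-injective e
  ... | refl rewrite <ᵇ-false a = cong 𝟙 (sym (F-irr i))

-- The number of distinct values among the three slots, hence the number of edges at a vertex
-- covered by three matchings using these slots there.
covered : (c₁ c₂ c₃ : Fin 3) → ℕ
covered c₁ c₂ c₃ = ∑[ c < 3 ] 𝟙 (does (c ≟ c₁) ∨ does (c ≟ c₂) ∨ does (c ≟ c₃))

covered-cong : ∀ {c₁ c₂ c₃ d₁ d₂ d₃} → c₁ ≡ d₁ → c₂ ≡ d₂ → c₃ ≡ d₃ →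
  covered c₁ c₂ c₃ ≡ covered d₁ d₂ d₃
covered-cong refl refl refl = refl

-- Cubic graphs given by their neighbours

∧-true : ∀ {a b} → a ∧ b ≡ true → a ≡ true × b ≡ true
∧-true {true} {true} _ = refl , refl

iff-true : ∀ {a b} → (a ≡ true → b ≡ true) → (b ≡ true → a ≡ true) → a ≡ b
iff-true {true}  {true}  f g = refl
iff-true {true}  {false} f g = sym (f refl)
iff-true {false} {true}  f g = g refl
iff-true {false} {false} f g = refl

xor-self : ∀ a → a xor a ≡ false
xor-self false = refl
xor-self true  = refl

𝟙-mono : ∀ {a b} → (a ≡ true → b ≡ true) → 𝟙 a ≤ 𝟙 b
𝟙-mono {false} {b} f = z≤n
𝟙-mono {true}  {b} f = ≤-reflexive (cong 𝟙 (sym (f refl)))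

𝟙≤1 : ∀ b → 𝟙 b ≤ 1
𝟙≤1 false = z≤n
𝟙≤1 true  = ≤-refl

Reach-∷ʳ : ∀ {n} {A : Rel n} {u v w} → Reach A u v → A v w ≡ true → Reach A u w
Reach-∷ʳ here       h = step h here
Reach-∷ʳ (step g r) h = step g (Reach-∷ʳ r h)

-- The set is Boolean so that its boundary can be counted by a sum.
record Component {n} (A : Rel n) (u : Fin n) : Set where
  field
    S         : Fin n → Bool
    source    : S u ≡ true
    reachable : ∀ v → S v ≡ true → Reach A u v
    closed    : ∀ v w → S v ≡ true → A v w ≡ true → S w ≡ true

-- A set of reachable vertices grows along a leaving edge until none is left; `k` bounds the number
-- of vertices outside, which drops at every step.
component : ∀ {n} (A : Rel n) u → Component A u
component {n} A u = grow n (λ v → does (u ≟ v)) (dec-true (u ≟ u) refl) start (outside≤n _)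
  where
  outside : (Fin n → Bool) → ℕ
  outside S = ∑[ v < n ] 𝟙 (not (S v))
  outside≤n : ∀ S → outside S ≤ n
  outside≤n S = ≤-trans (sum-mono λ v → 𝟙≤1 (not (S v))) (≤-reflexive (trans (sum-const n 1) (*-identityʳ n)))
  start : ∀ v → does (u ≟ v) ≡ true → Reach A u v
  start v h with decided (u ≟ v) h
  ... | refl = here
  grow : ∀ k S → S u ≡ true → (∀ v → S v ≡ true → Reach A u v) → outside S ≤ k → Component A u
  grow k S Su reach bound
    with any? (λ v → any? λ w → (S v Bool.≟ true) ×-dec (A v w Bool.≟ true) ×-dec (S w Bool.≟ false))
  ... | no none = record
    { S = S ; source = Su ; reachable = reach
    ; closed = λ v w Sv Avw → Bool.¬-not λ Sw → none (v , w , Sv , Avw , Sw) }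
  ... | yes (v , w , Sv , Avw , Sw) = continue k bound
    where
    S′ : Fin n → Bool
    S′ x = S x ∨ does (w ≟ x)
    reach′ : ∀ x → S′ x ≡ true → Reach A u x
    reach′ x h with S x in Sx | w ≟ x
    ... | true  | _        = reach x Sx
    ... | false | yes refl = Reach-∷ʳ (reach v Sv) Avw
    shrinks : outside S′ + 1 ≤ outside S
    shrinks = begin
      outside S′ + 1
        ≡⟨ cong (outside S′ +_) (sum-δ w (λ _ → 1)) ⟨
      outside S′ + ∑[ x < n ] (δ w x * 1)
        ≡⟨ cong (outside S′ +_) (sum-cong λ x → *-identityʳ (δ w x)) ⟩
      outside S′ + ∑[ x < n ] δ w x
        ≡⟨ ∑-distrib-+ (λ x → 𝟙 (not (S′ x))) (δ w) ⟨
      ∑[ x < n ] (𝟙 (not (S′ x)) + δ w x)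
        ≤⟨ sum-mono pointwise ⟩
      outside S ∎
      where
      open ≤-Reasoning
      pointwise : ∀ x → 𝟙 (not (S′ x)) + δ w x ≤ 𝟙 (not (S x))
      pointwise x with w ≟ x
      ... | yes refl rewrite Sw = ≤-refl
      ... | no _ with S x
      ...   | true  = ≤-refl
      ...   | false = ≤-refl
    continue : ∀ k → outside S ≤ k → Component A u
    continue zero    h = contradiction (≤-trans (m≤n+m 1 (outside S′)) (≤-trans shrinks h)) λ ()
    continue (suc k) h = grow k S′ (cong (_∨ does (w ≟ u)) Su) reach′
      (≤-pred (≤-trans (≤-reflexive (+-comm 1 (outside S′))) (≤-trans shrinks h)))

-- Every vertex has three numbered slots. `back` makes adjacency symmetric, and injectivity makes
-- the degree exactly three.
module FromNeighbours {n : ℕ} (nb : Fin n → Fin 3 → Fin n)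
  (back : ∀ v c → ∃[ d ] nb (nb v c) d ≡ v)
  (nb-injective : ∀ v c d → nb v c ≡ nb v d → c ≡ d)
  (nb-irreflexive : ∀ v c → nb v c ≢ v) where

  adjacent : Rel n
  adjacent v w = does (any? λ c → nb v c ≟ w)

  adjacent⇒nb : ∀ {v w} → adjacent v w ≡ true → ∃[ c ] nb v c ≡ w
  adjacent⇒nb {v} {w} = decided (any? λ c → nb v c ≟ w)

  adjacent-nb : ∀ v c → adjacent v (nb v c) ≡ true
  adjacent-nb v c = dec-true (any? λ d → nb v d ≟ nb v c) (c , refl)

  adjacent-sym⇒ : ∀ v w → adjacent v w ≡ true → adjacent w v ≡ true
  adjacent-sym⇒ v w h with adjacent⇒nb h
  ... | c , refl = dec-true (any? λ d → nb (nb v c) d ≟ v) (back v c)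

  graph : Graph
  graph = record
    { n      = n
    ; adj    = adjacent
    ; sym    = λ v w → iff-true (adjacent-sym⇒ v w) (adjacent-sym⇒ w v)
    ; irrefl = λ v → dec-false (any? λ c → nb v c ≟ v) λ (c , e) → nb-irreflexive v c e
    }

  deg-slots : (F : Rel n) → ∀ v → (∀ w → F v w ≡ true → adjacent v w ≡ true) →
    deg F v ≡ ∑[ c < 3 ] 𝟙 (F v (nb v c))
  deg-slots F v F⊆ = trans (deg-sum F v)
    (sum-supported (nb v) (nb-injective v) (λ w → 𝟙 (F v w)) support)
    where
    support : ∀ w → (∃[ c ] nb v c ≡ w) ⊎ 𝟙 (F v w) ≡ 0
    support w with F v w in eq
    ... | true  = inj₁ (adjacent⇒nb (F⊆ w eq))
    ... | false = inj₂ refl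

  cubic : Cubic graph
  cubic v = trans (deg-slots adjacent v (λ _ h → h)) (sum-cong {3} λ c → cong 𝟙 (adjacent-nb v c))

  countEdges-slots : (F : Rel n) → EdgeSet graph F →
    2 * countEdges F ≡ ∑[ v < n ] ∑[ c < 3 ] 𝟙 (F v (nb v c))
  countEdges-slots F (F-sym , F⊆) = trans
    (handshake F F-sym λ v → Bool.¬-not λ h → contradiction (trans (sym (F⊆ v v h)) (Graph.irrefl graph v)) λ ())
    (sum-cong λ v → deg-slots F v (F⊆ v))

  countEdges-adjacent : 2 * countEdges adjacent ≡ n * 3
  countEdges-adjacent = trans
    (handshake adjacent (Graph.sym graph) (Graph.irrefl graph))
    (trans (sum-cong cubic) (sum-const n 3))

  -- Every edge of the cut is counted twice.
  boundary : (Fin n → Bool) → ℕ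
  boundary S = ∑[ v < n ] ∑[ c < 3 ] 𝟙 (S v xor S (nb v c))

  -- The trivial cuts: at most one vertex `w` lies on the side opposite to `b`.
  AlmostConstant : (Fin n → Bool) → Set
  AlmostConstant S = Σ Bool λ b → ∃[ w ] ∀ v → v ≡ w ⊎ S v ≡ b

  -- Since the boundary counts edges twice, 8 stands for four edges: smaller cuts are trivial. Both
  -- connectivity properties are derived from this.
  module _ (boundary≥8 : ∀ S → 8 ≤ boundary S ⊎ AlmostConstant S) where

    private
      chain-constant : (A : Rel n) (S : Fin n → Bool) → (∀ v w → A v w ≡ true → S v ≡ S w) →
        ∀ x ys → Chain A x ys → All (λ y → S x ≡ S y) ys
      chain-constant A S const x []       _       = []
      chain-constant A S const x (y ∷ ys) (h , g) =
        const x y h ∷ All.map (trans (const x y h)) (chain-constant A S const y ys g)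

      cycle-pair : (A : Rel n) (S : Fin n → Bool) → (∀ v w → A v w ≡ true → S v ≡ S w) →
        ∀ c {u} → IsCycle A c → u ∈ c → ∃[ x ] ∃[ y ] x ≢ y × S x ≡ S u × S y ≡ S u
      cycle-pair A S const (x ∷ y ∷ ys) {u} (((x≢y ∷ _) ∷ _) , _ , ch) u∈ =
        x , y , x≢y , x≈u , trans (sym (All.head all)) x≈u
        where
        all : All (λ z → S x ≡ S z) (y ∷ ys)
        all = All.++⁻ˡ (y ∷ ys) (chain-constant A S const x _ ch)
        x≈u : S x ≡ S u
        x≈u = All.lookup (refl ∷ all) u∈
      cycle-pair A S const (x ∷ []) (_ , s≤s () , _) _

      almostConstant-pair : ∀ {S} → ((b , _) : AlmostConstant S) → ∀ {x y b′} → x ≢ y →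
        S x ≡ b′ → S y ≡ b′ → b ≡ b′
      almostConstant-pair (b , w , h) {x} {y} x≢y Sx Sy with h x | h y
      ... | inj₂ e    | _         = trans (sym e) Sx
      ... | inj₁ _    | inj₂ e    = trans (sym e) Sy
      ... | inj₁ refl | inj₁ refl = contradiction refl x≢y

    -- Take the component of `u` after deleting `F`: all its boundary edges lie in `F`. The cut is
    -- not trivial, because each of the two cycles stays on one side and has two distinct vertices
    -- there.
    cyclicallyConnected : CyclicallyConnected graph 4
    cyclicallyConnected F F-edges@(F-sym , _) (c₁ , c₂ , cyc₁ , cyc₂ , u , v , u∈ , v∈ , unreachable)
      = *-cancelˡ-≤ 2 (bound (boundary≥8 S))
      where
      A : Rel n
      A = deleteEdges graph F
      open Component (component A u)
      A-sym : ∀ x y → A x y ≡ A y x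
      A-sym x y = cong₂ (λ a b → a ∧ not b) (Graph.sym graph x y) (F-sym x y)
      const : ∀ x y → A x y ≡ true → S x ≡ S y
      const x y h = iff-true (λ Sx → closed x y Sx h) (λ Sy → closed y x Sy (trans (A-sym y x) h))
      Sv : S v ≡ false
      Sv = Bool.¬-not λ h → unreachable (reachable v h)
      crossing : ∀ x c → S x xor S (nb x c) ≡ true → F x (nb x c) ≡ true
      crossing x c h with F x (nb x c) in eq
      ... | true  = refl
      ... | false = trans (sym (xor-self (S (nb x c)))) (trans (cong (_xor S (nb x c)) (sym same)) h)
        where
        same : S x ≡ S (nb x c)
        same = const x (nb x c) (cong₂ (λ a b → a ∧ not b) (adjacent-nb x c) eq)
      bound : 8 ≤ boundary S ⊎ AlmostConstant S → 8 ≤ 2 * countEdges F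
      bound (inj₁ h) = ≤-trans h (≤-trans (sum-mono λ x → sum-mono λ c → 𝟙-mono (crossing x c))
                                          (≤-reflexive (sym (countEdges-slots F F-edges))))
      bound (inj₂ ac) with cycle-pair A S const c₁ cyc₁ u∈ | cycle-pair A S const c₂ cyc₂ v∈
      ... | x₁ , y₁ , d₁ , p₁ , q₁ | x₂ , y₂ , d₂ , p₂ , q₂ = contradiction
        (trans (sym (almostConstant-pair ac d₁ (trans p₁ source) (trans q₁ source)))
               (almostConstant-pair ac d₂ (trans p₂ Sv) (trans q₂ Sv)))
        λ ()

    -- If `v` were outside the component of `u` after deleting the edge, the cut would be too small
    -- to be nontrivial, so `u` or `v` would be alone on its side. But each of them has another
    -- neighbour, joined to it by a kept edge.
    bridgeless : Bridgeless graph
    bridgeless u v uv = connect (S v) refl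
      where
      A : Rel n
      A i j = adjacent i j ∧ not ((i =ᶠ u ∧ j =ᶠ v) ∨ (i =ᶠ v ∧ j =ᶠ u))
      open Component (component A u)
      OnEdge : Fin n → Fin n → Set
      OnEdge x y = (x ≡ u × y ≡ v) ⊎ (x ≡ v × y ≡ u)
      swap : ∀ {x y} → OnEdge x y → OnEdge y x
      swap (inj₁ (p , q)) = inj₂ (q , p)
      swap (inj₂ (p , q)) = inj₁ (q , p)
      u≢v : u ≢ v
      u≢v e with adjacent⇒nb uv
      ... | c , nb≡v = nb-irreflexive u c (trans nb≡v (sym e))
      kept : ∀ x y → adjacent x y ≡ true → ¬ OnEdge x y → A x y ≡ true
      kept x y xy off = cong₂ (λ a b → a ∧ not b) xy (Bool.¬-not (off ∘ ends))
        where
        =ᶠ⇒≡ : ∀ {i j : Fin n} → i =ᶠ j ≡ true → i ≡ j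
        =ᶠ⇒≡ {i} {j} h = toℕ-injective (≡ᵇ⇒≡ (toℕ i) (toℕ j) (subst T (sym h) tt))
        both : ∀ {i j k l : Fin n} → (i =ᶠ j) ∧ (k =ᶠ l) ≡ true → i ≡ j × k ≡ l
        both h with ∧-true h
        ... | p , q = =ᶠ⇒≡ p , =ᶠ⇒≡ q
        ends : (x =ᶠ u ∧ y =ᶠ v) ∨ (x =ᶠ v ∧ y =ᶠ u) ≡ true → OnEdge x y
        ends h with x =ᶠ u ∧ y =ᶠ v in e
        ... | true  = inj₁ (both e)
        ... | false = inj₂ (both h)
      same : ∀ x c → ¬ OnEdge x (nb x c) → S x ≡ S (nb x c)
      same x c off = iff-true
        (λ h → closed x (nb x c) h (kept x (nb x c) (adjacent-nb x c) off))
        (λ h → closed (nb x c) x h (kept (nb x c) x (adjacent-sym⇒ _ _ (adjacent-nb x c)) (off ∘ swap)))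
      another-nb : ∀ x y → ∃[ c ] nb x c ≢ y
      another-nb x y with nb x 0F ≟ y
      ... | no  nb≢y = 0F , nb≢y
      ... | yes refl = 1F , λ e → contradiction (nb-injective x 1F 0F e) λ ()
      not-isolated : ∀ x y → OnEdge x y → (∀ z → z ≢ x → S z ≢ S x) → ⊥
      not-isolated x y xy isolated with another-nb x y
      ... | c , nb≢y = isolated (nb x c) (nb-irreflexive x c) (sym (same x c (off xy)))
        where
        off : OnEdge x y → ¬ OnEdge x (nb x c)
        off (inj₁ (_ , y≡v))   (inj₁ (_ , e))   = nb≢y (trans e (sym y≡v))
        off (inj₁ (x≡u , _))   (inj₂ (x≡v , _)) = u≢v (trans (sym x≡u) x≡v)
        off (inj₂ (x≡v , _))   (inj₁ (x≡u , _)) = u≢v (trans (sym x≡u) x≡v)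
        off (inj₂ (_ , y≡u))   (inj₂ (_ , e))   = nb≢y (trans e (sym y≡u))
      -- Only the rows of `u` and `v` can be nonzero. Bounding each by its three slots is crude but
      -- stays below 8.
      boundary≤6 : boundary S ≤ 6
      boundary≤6 = begin
        boundary S                                                     ≤⟨ sum-mono row ⟩
        ∑[ x < n ] (δ u x * 3 + δ v x * 3)                             ≡⟨ ∑-distrib-+ (λ x → δ u x * 3) _ ⟩
        ∑[ x < n ] (δ u x * 3) + ∑[ x < n ] (δ v x * 3)                ≡⟨ cong₂ _+_ (sum-δ u (λ _ → 3)) (sum-δ v (λ _ → 3)) ⟩
        6                                                              ∎
        where
        open ≤-Reasoning
        row≤3 : ∀ x → ∑[ c < 3 ] 𝟙 (S x xor S (nb x c)) ≤ 3
        row≤3 x = sum-mono {3} λ c → 𝟙≤1 (S x xor S (nb x c))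
        row : ∀ x → ∑[ c < 3 ] 𝟙 (S x xor S (nb x c)) ≤ δ u x * 3 + δ v x * 3
        row x with u ≟ x | v ≟ x
        ... | yes _   | _       = ≤-trans (row≤3 x) (m≤m+n 3 _)
        ... | no _    | yes _   = row≤3 x
        ... | no u≢x  | no v≢x  = ≤-reflexive (sum-zero {3} λ c → cong 𝟙
          (trans (cong (_xor S (nb x c)) (same x c λ where
            (inj₁ (x≡u , _)) → u≢x (sym x≡u)
            (inj₂ (x≡v , _)) → v≢x (sym x≡v))) (xor-self (S (nb x c)))))
      connect : ∀ b → S v ≡ b → Reach A u v
      connect true  Sv = reachable v Sv
      connect false Sv with boundary≥8 S
      ... | inj₁ h = contradiction (≤-trans h boundary≤6) λ { (s≤s (s≤s (s≤s (s≤s (s≤s (s≤s ())))))) }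
      ... | inj₂ (b , w , h) with h u | h v
      ...   | inj₁ refl | inj₁ e    = contradiction (sym e) u≢v
      ...   | inj₂ p    | inj₂ q    = contradiction (trans (trans (sym source) p) (trans (sym q) Sv)) λ ()
      ...   | inj₁ refl | inj₂ q    = ⊥-elim (not-isolated u v (inj₁ (refl , refl)) λ z z≢u → λ e →
        contradiction (trans (trans (sym (rest z z≢u)) e) source) (subst (_≢ true) (trans (sym Sv) q) λ ()))
        where
        rest : ∀ z → z ≢ u → S z ≡ b
        rest z z≢u with h z
        ... | inj₁ z≡u = contradiction z≡u z≢u
        ... | inj₂ e   = e
      ...   | inj₂ p    | inj₁ refl = ⊥-elim (not-isolated v u (inj₂ (refl , refl)) λ z z≢v → λ e →
        contradiction (trans (trans (sym (rest z z≢v)) e) Sv) (subst (_≢ false) (trans (sym source) p) λ ()))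
        where
        rest : ∀ z → z ≢ v → S z ≡ b
        rest z z≢v with h z
        ... | inj₁ z≡v = contradiction z≡v z≢v
        ... | inj₂ e   = e

  Slots : Rel n → (Fin n → Fin 3) → Set
  Slots M μ = ∀ v c → M v (nb v c) ≡ does (c ≟ μ v)

  abstract
    slots : ∀ M → PerfectMatching graph M → Σ (Fin n → Fin 3) (Slots M)
    slots M ((_ , M⊆) , deg≡1) = (λ v → proj₁ (at v)) , λ v → proj₂ (at v)
      where
      unique-slot : (f : Fin 3 → Bool) → ∑[ c < 3 ] 𝟙 (f c) ≡ 1 → ∃[ m ] ∀ c → f c ≡ does (c ≟ m)
      unique-slot f h with f 0F in e₀ | f 1F in e₁ | f 2F in e₂
      ... | true  | false | false = 0F , λ { 0F → e₀ ; 1F → e₁ ; 2F → e₂ }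
      ... | false | true  | false = 1F , λ { 0F → e₀ ; 1F → e₁ ; 2F → e₂ }
      ... | false | false | true  = 2F , λ { 0F → e₀ ; 1F → e₁ ; 2F → e₂ }
      unique-slot f () | true | true | _
      unique-slot f () | true | false | true
      unique-slot f () | false | true | true
      unique-slot f () | false | false | false
      at : ∀ v → ∃[ m ] ∀ c → M v (nb v c) ≡ does (c ≟ m)
      at v = unique-slot (λ c → M v (nb v c)) (trans (sym (deg-slots M v (M⊆ v))) (deg≡1 v))

  -- An edge belongs to the matching as seen from one end exactly when it does as seen from the
  -- other.
  slots-across : ∀ {M μ} → EdgeSet graph M → Slots M μ →
    ∀ v c d → nb (nb v c) d ≡ v → does (c ≟ μ v) ≡ does (d ≟ μ (nb v c))
  slots-across {M} (M-sym , _) M-slots v c d e = trans (sym (M-slots v c))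
    (trans (M-sym v (nb v c)) (trans (cong (M (nb v c)) (sym e)) (M-slots (nb v c) d)))

  union-count : ∀ {M₁ M₂ M₃ μ₁ μ₂ μ₃} →
    EdgeSet graph M₁ → EdgeSet graph M₂ → EdgeSet graph M₃ →
    Slots M₁ μ₁ → Slots M₂ μ₂ → Slots M₃ μ₃ →
    2 * countEdges (union3 graph M₁ M₂ M₃) ≡ ∑[ v < n ] covered (μ₁ v) (μ₂ v) (μ₃ v)
  union-count {M₁} {M₂} {M₃} (sym₁ , ⊆₁) (sym₂ , ⊆₂) (sym₃ , ⊆₃) s₁ s₂ s₃ = trans
    (countEdges-slots (union3 graph M₁ M₂ M₃)
      ((λ v w → cong₂ _∨_ (sym₁ v w) (cong₂ _∨_ (sym₂ v w) (sym₃ v w))) , subset))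
    (sum-cong λ v → sum-cong {3} λ c →
      cong 𝟙 (cong₂ _∨_ (s₁ v c) (cong₂ _∨_ (s₂ v c) (s₃ v c))))
    where
    subset : ∀ v w → union3 graph M₁ M₂ M₃ v w ≡ true → adjacent v w ≡ true
    subset v w h with M₁ v w in e₁ | M₂ v w in e₂ | M₃ v w in e₃
    ... | true  | _     | _    = ⊆₁ v w e₁
    ... | false | true  | _    = ⊆₂ v w e₂
    ... | false | false | true = ⊆₃ v w e₃

  -- The converse of `slots`: a choice of slots comes from a perfect matching as soon as chosen
  -- neighbours choose each other.
  module Matching (μ : Fin n → Fin 3) (mutual-slots : ∀ v → nb (nb v (μ v)) (μ (nb v (μ v))) ≡ v) where

    matching : Rel n
    matching v w = does (nb v (μ v) ≟ w)

    private
      sym⇒ : ∀ v w → matching v w ≡ true → matching w v ≡ true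
      sym⇒ v w h with decided (nb v (μ v) ≟ w) h
      ... | refl = dec-true (nb w (μ w) ≟ v) (mutual-slots v)

    edgeSet : EdgeSet graph matching
    edgeSet = (λ v w → iff-true (sym⇒ v w) (sym⇒ w v)) ,
      λ v w h → subst (λ z → adjacent v z ≡ true) (decided (nb v (μ v) ≟ w) h) (adjacent-nb v (μ v))

    matching-slots : Slots matching μ
    matching-slots v c with c ≟ μ v
    ... | yes refl = dec-true (nb v c ≟ nb v c) refl
    ... | no  c≢μ  = dec-false (nb v (μ v) ≟ nb v c) λ e → c≢μ (sym (nb-injective v (μ v) c e))

    perfectMatching : PerfectMatching graph matching
    perfectMatching = edgeSet , λ v → trans
      (deg-slots matching v (proj₂ edgeSet v))
      (trans (sum-cong {3} λ c → cong 𝟙 (matching-slots v c)) (one (μ v)))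
      where
      one : ∀ m → ∑[ c < 3 ] 𝟙 (does (c ≟ m)) ≡ 1
      one 0F = refl
      one 1F = refl
      one 2F = refl

  -- A triangle is a two-step walk ending at a neighbour of its start. A square, with its last two
  -- edges reversed, is a pair of two-step walks from `a` to `c`: `b≢d` excludes a common middle
  -- vertex and `a≢c` a return.
  girth≥5 : (∀ v s t u → nb (nb v s) t ≢ nb v u) →
    (∀ v s s′ t t′ → nb (nb v s) t ≡ nb (nb v s′) t′ → s ≡ s′ ⊎ nb (nb v s) t ≡ v) →
    ∀ c → IsCycle adjacent c → 5 ≤ length c
  girth≥5 no-triangle no-square (_ ∷ []) (_ , s≤s () , _)
  girth≥5 no-triangle no-square (_ ∷ _ ∷ []) (_ , s≤s (s≤s ()) , _)
  girth≥5 no-triangle no-square (a ∷ b ∷ c ∷ []) (_ , _ , ab , bc , ca , _)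
    with adjacent⇒nb ab | adjacent⇒nb bc | adjacent⇒nb (adjacent-sym⇒ c a ca)
  ... | s , refl | t , refl | u , e = contradiction (sym e) (no-triangle a s t u)
  girth≥5 no-triangle no-square (a ∷ b ∷ c ∷ d ∷ [])
    (((_ ∷ a≢c ∷ _) ∷ (_ ∷ b≢d ∷ _) ∷ _) , _ , ab , bc , cd , da , _)
    with adjacent⇒nb ab | adjacent⇒nb bc | adjacent⇒nb (adjacent-sym⇒ d a da) | adjacent⇒nb (adjacent-sym⇒ c d cd)
  ... | s , refl | t , refl | s′ , refl | t′ , e with no-square a s s′ t t′ (sym e)
  ...   | inj₁ refl = contradiction refl b≢d
  ...   | inj₂ c≡a  = contradiction (sym c≡a) a≢c
  girth≥5 no-triangle no-square (_ ∷ _ ∷ _ ∷ _ ∷ _ ∷ _) _ = s≤s (s≤s (s≤s (s≤s (s≤s z≤n))))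

-- Cyclic order on Fin (suc m)

prev next : ∀ {m} → Fin (suc m) → Fin (suc m)
prev {m} zero    = fromℕ m
prev     (suc i) = inject₁ i
next i with view i
... | ‵fromℕ     = zero
... | ‵inject₁ j = suc j

next-inject₁ : ∀ {m} (i : Fin m) → next (inject₁ i) ≡ suc i
next-inject₁ i rewrite view-inject₁ i = refl

next-fromℕ : ∀ m → next (fromℕ m) ≡ zero
next-fromℕ m rewrite view-fromℕ m = refl

next-prev : ∀ {m} (i : Fin (suc m)) → next (prev i) ≡ i
next-prev {m} zero    = next-fromℕ m
next-prev     (suc i) = next-inject₁ i

prev-next : ∀ {m} (i : Fin (suc m)) → prev (next i) ≡ i
prev-next i with view i
... | ‵fromℕ     = refl
... | ‵inject₁ j = refl

toℕ-next : ∀ {m} (i : Fin (suc m)) → toℕ (next i) ≡ suc (toℕ i) ⊎ (toℕ (next i) ≡ 0 × toℕ i ≡ m)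
toℕ-next i with view i
... | ‵fromℕ {m} = inj₂ (refl , toℕ-fromℕ m)
... | ‵inject₁ j = inj₁ (cong suc (sym (toℕ-inject₁ j)))

sum-next : ∀ {m} (f : Fin (suc m) → ℕ) → sum (f ∘ next) ≡ sum f
sum-next f = sym (sum-permute f (permutation next prev next-prev prev-next))

iter : ∀ {A : Set} → (A → A) → ℕ → A → A
iter f zero    x = x
iter f (suc k) x = f (iter f k x)

iter-+ : ∀ {A : Set} (f : A → A) j k x → iter f (j + k) x ≡ iter f j (iter f k x)
iter-+ f zero    k x = refl
iter-+ f (suc j) k x = cong f (iter-+ f j k x)

next-transitive : ∀ {m} (i j : Fin (suc m)) → ∃[ k ] iter next k i ≡ j
next-transitive {m} i j with to-zero i | from-zero j
  where
  from-zero : ∀ j → ∃[ k ] iter next k zero ≡ j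
  from-zero = <-weakInduction _ (0 , refl) λ j (k , e) → suc k , trans (cong next e) (next-inject₁ j)
  to-zero : ∀ i → ∃[ k ] iter next k i ≡ zero
  to-zero = >-weakInduction _ (1 , next-fromℕ m) λ i (k , e) →
    k + 1 , trans (iter-+ next k 1 (inject₁ i)) (trans (cong (iter next k) (next-inject₁ i)) e)
... | k , e | l , e′ = l + k , trans (iter-+ next l k i) (trans (cong (iter next l) e) e′)

-- Let `w` count the passages from the last position to zero. A return after `suc k` steps gives
-- `w * suc m ≡ suc k`, impossible for `suc k` between 1 and `m`.
next-acyclic : ∀ {m} k (i : Fin (suc m)) → k < m → iter next (suc k) i ≢ i
next-acyclic {m} k i k<m e with winding (suc k)
  where
  winding : ∀ k → ∃[ w ] toℕ (iter next k i) + w * suc m ≡ toℕ i + k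
  winding zero    = 0 , refl
  winding (suc k) with winding k | toℕ-next (iter next k i)
  ... | w , h | inj₁ s       = w , trans (cong (_+ w * suc m) s) (trans (cong suc h) (sym (+-suc (toℕ i) k)))
  ... | w , h | inj₂ (z , t) = suc w , trans (cong (_+ suc w * suc m) z)
    (trans (cong (λ l → suc (l + w * suc m)) (sym t)) (trans (cong suc h) (sym (+-suc (toℕ i) k))))
... | w , h with +-cancelˡ-≡ (toℕ i) (w * suc m) (suc k) (trans (cong (λ j → toℕ j + w * suc m) (sym e)) h)
...   | eq with w
...     | zero  = contradiction eq λ ()
...     | suc w = contradiction (≤-trans (s≤s k<m) (≤-trans (m≤m+n (suc m) (w * suc m)) (≤-reflexive eq))) (n≮n (suc k))

sum-combine : ∀ m {k} (f : Fin (m * k) → ℕ) → sum f ≡ ∑[ i < m ] ∑[ x < k ] f (combine i x)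
sum-combine zero        f = refl
sum-combine (suc m) {k} f = trans (sum-↑ k f) (cong (∑[ x < k ] f (x ↑ˡ (m * k)) +_) (sum-combine m (f ∘ (k ↑ʳ_))))
  where
  sum-↑ : ∀ k {l} (f : Fin (k + l) → ℕ) → sum f ≡ ∑[ x < k ] f (x ↑ˡ l) + ∑[ y < l ] f (k ↑ʳ y)
  sum-↑ zero    f = refl
  sum-↑ (suc k) f = trans (cong (f zero +_) (sum-↑ k (f ∘ suc))) (sym (+-assoc (f zero) _ _))

-- Blocks

-- Where an edge leads: into the same block, the previous block, or the next block.
data Port : Set where
  inn lft rgt : Fin 10 → Port

-- false is plain, true is twisted.
Kind : Set
Kind = Bool

-- Plain: the Petersen graph without the edges 0–1 and 8–9. Twisted: the Petersen graph without two
-- adjacent vertices, one of them adjacent to 0 and 1, the neighbours 5 and 6 of the other being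
-- joined to the ends of the rung 8–9. The junction edges always occupy slot 0 at 0, 1, 8 and 9.
block : Kind → Vec (Vec Port 3) 10
block false =
    (lft (# 8) ∷ inn (# 4) ∷ inn (# 5) ∷ [])
  ∷ (lft (# 9) ∷ inn (# 2) ∷ inn (# 6) ∷ [])
  ∷ (inn (# 1) ∷ inn (# 3) ∷ inn (# 8) ∷ [])
  ∷ (inn (# 2) ∷ inn (# 4) ∷ inn (# 7) ∷ [])
  ∷ (inn (# 0) ∷ inn (# 3) ∷ inn (# 9) ∷ [])
  ∷ (inn (# 0) ∷ inn (# 8) ∷ inn (# 7) ∷ [])
  ∷ (inn (# 1) ∷ inn (# 7) ∷ inn (# 9) ∷ [])
  ∷ (inn (# 3) ∷ inn (# 5) ∷ inn (# 6) ∷ [])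
  ∷ (rgt (# 0) ∷ inn (# 2) ∷ inn (# 5) ∷ [])
  ∷ (rgt (# 1) ∷ inn (# 4) ∷ inn (# 6) ∷ [])
  ∷ []
block true =
    (lft (# 8) ∷ inn (# 2) ∷ inn (# 4) ∷ [])
  ∷ (lft (# 9) ∷ inn (# 3) ∷ inn (# 7) ∷ [])
  ∷ (inn (# 0) ∷ inn (# 3) ∷ inn (# 5) ∷ [])
  ∷ (inn (# 2) ∷ inn (# 1) ∷ inn (# 6) ∷ [])
  ∷ (inn (# 0) ∷ inn (# 6) ∷ inn (# 7) ∷ [])
  ∷ (inn (# 2) ∷ inn (# 7) ∷ inn (# 8) ∷ [])
  ∷ (inn (# 3) ∷ inn (# 4) ∷ inn (# 9) ∷ [])
  ∷ (inn (# 1) ∷ inn (# 4) ∷ inn (# 5) ∷ [])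
  ∷ (rgt (# 0) ∷ inn (# 5) ∷ inn (# 9) ∷ [])
  ∷ (rgt (# 1) ∷ inn (# 6) ∷ inn (# 8) ∷ [])
  ∷ []

port : Kind → Fin 10 → Fin 3 → Port
port t x c = lookup (lookup (block t) x) c

_≟ᵖ_ : (p q : Port) → Dec (p ≡ q)
inn x ≟ᵖ inn y = map′ (cong inn) (λ { refl → refl }) (x ≟ y)
lft x ≟ᵖ lft y = map′ (cong lft) (λ { refl → refl }) (x ≟ y)
rgt x ≟ᵖ rgt y = map′ (cong rgt) (λ { refl → refl }) (x ≟ y)
inn _ ≟ᵖ lft _ = no λ ()
inn _ ≟ᵖ rgt _ = no λ ()
lft _ ≟ᵖ inn _ = no λ ()
lft _ ≟ᵖ rgt _ = no λ ()
rgt _ ≟ᵖ inn _ = no λ ()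
rgt _ ≟ᵖ lft _ = no λ ()

allKinds? : ∀ {P : Kind → Set} → (∀ t → Dec (P t)) → Dec (∀ t → P t)
allKinds? P? = map′ (λ { (f , t) false → f ; (f , t) true → t }) (λ h → h false , h true)
                 (P? false ×-dec P? true)

-- Meaningful only if x and y are adjacent.
slotTo : Kind → Fin 10 → Fin 10 → Fin 3
slotTo t y x =
  if does (port t y 0F ≟ᵖ inn x) then 0F else (if does (port t y 1F ≟ᵖ inn x) then 1F else 2F)

-- The slot at the far end that leads back to `x`; a junction edge has slot 0 at both ends.
backSlot : Kind → Fin 10 → Port → Fin 3
backSlot t x (inn y) = slotTo t y x
backSlot t x (lft _) = 0F
backSlot t x (rgt _) = 0F

-- The kind of the neighbouring block is unknown locally, so across a junction both kinds `t′` are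
-- required to answer alike.
Returns : Kind → Fin 10 → Port → Set
Returns t x (inn y) = port t y (slotTo t y x) ≡ inn x
Returns t x (lft y) = ∀ t′ → port t′ y 0F ≡ rgt x
Returns t x (rgt y) = ∀ t′ → port t′ y 0F ≡ lft x

returns? : ∀ t x p → Dec (Returns t x p)
returns? t x (inn y) = port t y (slotTo t y x) ≟ᵖ inn x
returns? t x (lft y) = allKinds? λ t′ → port t′ y 0F ≟ᵖ rgt x
returns? t x (rgt y) = allKinds? λ t′ → port t′ y 0F ≟ᵖ lft x

-- The exhaustive checks are abstract because unfolding them during unification is prohibitive.
abstract
  returns : ∀ t x c → Returns t x (port t x c)
  returns = decided (allKinds? λ t → all? λ x → all? λ c → returns? t x (port t x c)) refl

allVec? : ∀ n {P : Vec Bool n → Set} → (∀ v → Dec (P v)) → Dec (∀ v → P v)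
allVec? zero    P? = map′ (λ { p [] → p }) (λ h → h []) (P? [])
allVec? (suc n) P? =
  map′ (λ { (f , t) (false ∷ v) → f v ; (f , t) (true ∷ v) → t v })
       (λ h → (λ v → h (false ∷ v)) , (λ v → h (true ∷ v)))
       (allVec? n (λ v → P? (false ∷ v)) ×-dec allVec? n (λ v → P? (true ∷ v)))

innerTerm : Vec Bool 10 → Fin 10 → Port → ℕ
innerTerm w x (inn y) = 𝟙 (lookup w x xor lookup w y)
innerTerm w x (lft _) = 0
innerTerm w x (rgt _) = 0

-- Every inner edge is counted twice.
inner : Kind → Vec Bool 10 → ℕ
inner t w = ∑[ x < 10 ] ∑[ c < 3 ] innerTerm w x (port t x c)

junction : Vec Bool 10 → Vec Bool 10 → ℕ
junction w w′ = 𝟙 (lookup w 8F xor lookup w′ 0F) + 𝟙 (lookup w 9F xor lookup w′ 1F)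

abstract
  -- Blocks are 2-edge-connected: splitting one cuts two inner edges, each counted twice.
  inner-nonconstant : ∀ t w → 4 ≤ inner t w ⊎ ∀ x → lookup w x ≡ lookup w 0F
  inner-nonconstant = decided (allKinds? λ t → allVec? 10 λ w →
    (4 ≤? inner t w) ⊎-dec all? λ x → lookup w x Bool.≟ lookup w 0F) refl

-- The boundary contributed by a block and its two junctions when all other blocks have colour `b`.
-- The factor 2 matches the double count in `inner`.
cost : Kind → Bool → Vec Bool 10 → ℕ
cost t b w = inner t w + 2 * junction w (replicate 10 b) + 2 * junction (replicate 10 b) w

abstract
  -- The finite core of cyclic 4-connectivity: inside one block, fewer than four cut edges can
  -- separate at most one vertex from the rest of the ring.
  inner-exceptional : ∀ t b w → 8 ≤ cost t b w ⊎ ∃[ x₀ ] ∀ x → x ≡ x₀ ⊎ lookup w x ≡ b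
  inner-exceptional = decided (allKinds? λ t → allKinds? λ b → allVec? 10 λ w →
    (8 ≤? cost t b w) ⊎-dec any? λ x₀ → all? λ x → (x ≟ x₀) ⊎-dec (lookup w x Bool.≟ b)) refl

-- Rings of blocks

abstract
  port-injective : ∀ t x c d → port t x c ≡ port t x d → c ≡ d
  port-injective = decided (allKinds? λ t → all? λ x → all? λ c → all? λ d →
    (port t x c ≟ᵖ port t x d) →-dec (c ≟ d)) refl

abstract
  port-irreflexive : ∀ t x c → port t x c ≢ inn x
  port-irreflexive = decided (allKinds? λ t → all? λ x → all? λ c → ¬? (port t x c ≟ᵖ inn x)) refl

-- Short walks are simulated in coordinates relative to the ring: the starting block has offset 2,
-- and two steps never leave the offsets 0 to 4, which are distinct blocks of a long enough ring.
move : ℕ → Port → ℕ × Fin 10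
move o (inn y) = o , y
move o (lft y) = pred o , y
move o (rgt y) = suc o , y

walk : (ℕ → Kind) → ℕ × Fin 10 → Fin 3 → ℕ × Fin 10
walk t (o , x) c = move o (port (t o) x c)

-- A walk of two steps from offset 2 consults kinds only at offsets 1 to 3, so the default matters
-- only at 3.
types : Kind → Kind → Kind → ℕ → Kind
types t₁ t₂ t₃ 1 = t₁
types t₁ t₂ t₃ 2 = t₂
types t₁ t₂ t₃ _ = t₃

walk₁ : Kind → Kind → Kind → Fin 10 → Fin 3 → ℕ × Fin 10
walk₁ t₁ t₂ t₃ x s = walk (types t₁ t₂ t₃) (2 , x) s

walk₂ : Kind → Kind → Kind → Fin 10 → Fin 3 → Fin 3 → ℕ × Fin 10
walk₂ t₁ t₂ t₃ x s t = walk (types t₁ t₂ t₃) (walk₁ t₁ t₂ t₃ x s) t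

_≟ʷ_ : (p q : ℕ × Fin 10) → Dec (p ≡ q)
_≟ʷ_ = ≡-dec ℕ._≟_ _≟_

abstract
  walk₁≤4 : ∀ t₁ t₂ t₃ x s → proj₁ (walk₁ t₁ t₂ t₃ x s) ≤ 4
  walk₁≤4 = decided (allKinds? λ t₁ → allKinds? λ t₂ → allKinds? λ t₃ → all? λ x → all? λ s →
    proj₁ (walk₁ t₁ t₂ t₃ x s) ≤? 4) refl

abstract
  walk₂≤4 : ∀ t₁ t₂ t₃ x s t → proj₁ (walk₂ t₁ t₂ t₃ x s t) ≤ 4
  walk₂≤4 = decided (allKinds? λ t₁ → allKinds? λ t₂ → allKinds? λ t₃ → all? λ x → all? λ s → all? λ t →
    proj₁ (walk₂ t₁ t₂ t₃ x s t) ≤? 4) refl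

abstract
  walk-no-triangle : ∀ t₁ t₂ t₃ x s t u → walk₂ t₁ t₂ t₃ x s t ≢ walk₁ t₁ t₂ t₃ x u
  walk-no-triangle = decided (allKinds? λ t₁ → allKinds? λ t₂ → allKinds? λ t₃ → all? λ x →
    all? λ s → all? λ t → all? λ u → ¬? (walk₂ t₁ t₂ t₃ x s t ≟ʷ walk₁ t₁ t₂ t₃ x u)) refl

abstract
  walk-no-square : ∀ t₁ t₂ t₃ x s s′ t t′ → walk₂ t₁ t₂ t₃ x s t ≡ walk₂ t₁ t₂ t₃ x s′ t′ →
    s ≡ s′ ⊎ walk₂ t₁ t₂ t₃ x s t ≡ (2 , x)
  walk-no-square = decided (allKinds? λ t₁ → allKinds? λ t₂ → allKinds? λ t₃ → all? λ x →
    all? λ s → all? λ s′ → all? λ t → all? λ t′ →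
    (walk₂ t₁ t₂ t₃ x s t ≟ʷ walk₂ t₁ t₂ t₃ x s′ t′) →-dec
      ((s ≟ s′) ⊎-dec (walk₂ t₁ t₂ t₃ x s t ≟ʷ (2 , x)))) refl

iter-next-distinct : ∀ {m} k l (i : Fin (suc m)) → k < l → l ≤ m → iter next l i ≢ iter next k i
iter-next-distinct k l i k<l l≤m e with m≤n⇒∃[o]m+o≡n k<l
... | d , refl = next-acyclic d (iter next k i) (≤-trans (s≤s (m≤n+m d k)) l≤m)
  (trans (sym (iter-+ next (suc d) k i)) (trans (cong (λ z → iter next (suc z) i) (+-comm d k)) e))

iter-next-injective : ∀ {m} k l (i : Fin (suc m)) → k ≤ m → l ≤ m →
  iter next k i ≡ iter next l i → k ≡ l
iter-next-injective k l i k≤m l≤m e with ℕ.<-cmp k l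
... | tri≈ _ k≡l _ = k≡l
... | tri< k<l _ _ = contradiction (sym e) (iter-next-distinct k l i k<l l≤m)
... | tri> _ _ l<k = contradiction e (iter-next-distinct l k i l<k k≤m)

-- The bound on `m` gives at least five blocks, so the offsets 0 to 4 denote distinct blocks.
module Ring {m : ℕ} (4≤m : 4 ≤ m) (τ : Fin (suc m) → Kind) where

  V : Set
  V = Fin (suc m * 10)

  at : Fin (suc m) → Fin 10 → V
  at = combine

  at-injective : ∀ i x j y → at i x ≡ at j y → i ≡ j × x ≡ y
  at-injective = combine-injective

  place : Fin (suc m) → Port → V
  place b (inn y) = at b y
  place b (lft y) = at (prev b) y
  place b (rgt y) = at (next b) y

  nb : V → Fin 3 → V
  nb v c = uncurry (λ b x → place b (port (τ b) x c)) (remQuot {suc m} 10 v)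

  nb-at : ∀ b x c → nb (at b x) c ≡ place b (port (τ b) x c)
  nb-at b x c = cong (uncurry λ b x → place b (port (τ b) x c)) (remQuot-combine b x)

  everywhere : ∀ {P : V → Set} → (∀ b x → P (at b x)) → ∀ v → P v
  everywhere {P} h v = subst P (combine-remQuot {suc m} 10 v)
    (h (proj₁ (remQuot {suc m} 10 v)) (proj₂ (remQuot {suc m} 10 v)))

  place-back : ∀ b x p → Returns (τ b) x p → nb (place b p) (backSlot (τ b) x p) ≡ at b x
  place-back b x (inn y) r = trans (nb-at b y _) (cong (place b) r)
  place-back b x (lft y) r = trans (nb-at (prev b) y 0F)
    (trans (cong (place (prev b)) (r (τ (prev b)))) (cong (λ i → at i x) (next-prev b)))
  place-back b x (rgt y) r = trans (nb-at (next b) y 0F)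
    (trans (cong (place (next b)) (r (τ (next b)))) (cong (λ i → at i x) (prev-next b)))

  nb-back : ∀ b x c → nb (nb (at b x) c) (backSlot (τ b) x (port (τ b) x c)) ≡ at b x
  nb-back b x c = trans (cong (λ v → nb v _) (nb-at b x c)) (place-back b x _ (returns (τ b) x c))

  next≢ : ∀ b → next b ≢ b
  next≢ b = next-acyclic 0 b (≤-trans (s≤s z≤n) 4≤m)

  prev≢ : ∀ b → prev b ≢ b
  prev≢ b e = next≢ (prev b) (trans (next-prev b) (sym e))

  next≢prev : ∀ b → next b ≢ prev b
  next≢prev b e = next-acyclic 1 (prev b) (≤-trans (s≤s (s≤s z≤n)) 4≤m)
    (trans (cong next (next-prev b)) e)

  -- The blocks `prev b`, `b` and `next b` are pairwise distinct, so the target vertex determines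
  -- the kind of port.
  place-injective : ∀ b p q → place b p ≡ place b q → p ≡ q
  place-injective b p q = go p q
    where
    blocks : ∀ {i j x y} → at i x ≡ at j y → i ≡ j
    blocks {i} {j} {x} {y} e = proj₁ (at-injective i x j y e)
    same : ∀ i {x y} → at i x ≡ at i y → x ≡ y
    same i {x} {y} e = proj₂ (at-injective i x i y e)
    go : ∀ p q → place b p ≡ place b q → p ≡ q
    go (inn x) (inn y) e = cong inn (same b e)
    go (lft x) (lft y) e = cong lft (same (prev b) e)
    go (rgt x) (rgt y) e = cong rgt (same (next b) e)
    go (inn x) (lft y) e = contradiction (sym (blocks e)) (prev≢ b)
    go (inn x) (rgt y) e = contradiction (sym (blocks e)) (next≢ b)
    go (lft x) (inn y) e = contradiction (blocks e) (prev≢ b)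
    go (lft x) (rgt y) e = contradiction (sym (blocks e)) (next≢prev b)
    go (rgt x) (inn y) e = contradiction (blocks e) (next≢ b)
    go (rgt x) (lft y) e = contradiction (blocks e) (next≢prev b)

  open FromNeighbours {suc m * 10} nb
    (everywhere λ b x c → backSlot (τ b) x (port (τ b) x c) , nb-back b x c)
    (everywhere λ b x c d e → port-injective (τ b) x c d
      (place-injective b _ _ (trans (sym (nb-at b x c)) (trans e (nb-at b x d)))))
    (everywhere λ b x c e → port-irreflexive (τ b) x c
      (place-injective b _ (inn x) (trans (sym (nb-at b x c)) e)))
    public

  module _ (b : Fin (suc m)) where

    private
      -- The block of offset 0, chosen so that `b` gets offset 2.
      j : Fin (suc m)
      j = prev (prev b)

      b≡ : iter next 2 j ≡ b
      b≡ = trans (cong next (next-prev (prev b))) (next-prev b)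

      t : ℕ → Kind
      t = types (τ (iter next 1 j)) (τ (iter next 2 j)) (τ (iter next 3 j))

      vertex : ℕ × Fin 10 → V
      vertex (o , x) = at (iter next o j) x

      vertex-injective : ∀ p q → proj₁ p ≤ 4 → proj₁ q ≤ 4 → vertex p ≡ vertex q → p ≡ q
      vertex-injective (o , x) (o′ , x′) o≤4 o′≤4 e
        with at-injective (iter next o j) x (iter next o′ j) x′ e
      ... | e₁ , e₂ = cong₂ _,_
        (iter-next-injective o o′ j (≤-trans o≤4 4≤m) (≤-trans o′≤4 4≤m) e₁) e₂

      -- The offset is a successor, so `pred` in `move` is a genuine step back.
      vertex-move : ∀ o p → place (iter next (suc o) j) p ≡ vertex (move (suc o) p)
      vertex-move o (inn y) = refl
      vertex-move o (lft y) = cong (λ i → at i y) (prev-next (iter next o j))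
      vertex-move o (rgt y) = refl

      nb-vertex : ∀ o x c → t (suc o) ≡ τ (iter next (suc o) j) →
        nb (vertex (suc o , x)) c ≡ vertex (walk t (suc o , x) c)
      nb-vertex o x c e = trans (nb-at (iter next (suc o) j) x c)
        (trans (vertex-move o (port (τ (iter next (suc o) j)) x c))
          (cong (λ t′ → vertex (move (suc o) (port t′ x c))) (sym e)))

      nb-move : ∀ p c → nb (vertex (move 2 p)) c ≡ vertex (walk t (move 2 p) c)
      nb-move (inn y) c = nb-vertex 1 y c refl
      nb-move (lft y) c = nb-vertex 0 y c refl
      nb-move (rgt y) c = nb-vertex 2 y c refl

    -- Walks in the ring are images under `vertex` of simulated walks, and `vertex-injective`
    -- reflects their coincidences to the finite checks. The proof is at `iter next 2 j`, where `t`
    -- computes, and is carried to `b` along `b≡`.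
    girth-local : ∀ x →
      (∀ s t u → nb (nb (at b x) s) t ≢ nb (at b x) u) ×
      (∀ s s′ t t′ → nb (nb (at b x) s) t ≡ nb (nb (at b x) s′) t′ → s ≡ s′ ⊎ nb (nb (at b x) s) t ≡ at b x)
    girth-local x = subst
      (λ i → (∀ s t u → nb (nb (at i x) s) t ≢ nb (at i x) u) ×
        (∀ s s′ t t′ → nb (nb (at i x) s) t ≡ nb (nb (at i x) s′) t′ → s ≡ s′ ⊎ nb (nb (at i x) s) t ≡ at i x))
      b≡ (triangle , square)
      where
      v : V
      v = vertex (2 , x)
      t₁ t₂ t₃ : Kind
      t₁ = τ (iter next 1 j)
      t₂ = τ (iter next 2 j)
      t₃ = τ (iter next 3 j)
      nb₁ : ∀ s → nb v s ≡ vertex (walk₁ t₁ t₂ t₃ x s)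
      nb₁ s = nb-vertex 1 x s refl
      nb₂ : ∀ s u → nb (nb v s) u ≡ vertex (walk₂ t₁ t₂ t₃ x s u)
      nb₂ s u = trans (cong (λ w → nb w u) (nb₁ s)) (nb-move (port t₂ x s) u)
      triangle : ∀ s t u → nb (nb v s) t ≢ nb v u
      triangle s t u e = walk-no-triangle t₁ t₂ t₃ x s t u
        (vertex-injective (walk₂ t₁ t₂ t₃ x s t) (walk₁ t₁ t₂ t₃ x u)
          (walk₂≤4 t₁ t₂ t₃ x s t) (walk₁≤4 t₁ t₂ t₃ x u)
          (trans (sym (nb₂ s t)) (trans e (nb₁ u))))
      square : ∀ s s′ t t′ → nb (nb v s) t ≡ nb (nb v s′) t′ → s ≡ s′ ⊎ nb (nb v s) t ≡ v
      square s s′ t t′ e = Sum.map₂ (λ q → trans (nb₂ s t) (cong vertex q))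
        (walk-no-square t₁ t₂ t₃ x s s′ t t′
          (vertex-injective (walk₂ t₁ t₂ t₃ x s t) (walk₂ t₁ t₂ t₃ x s′ t′)
            (walk₂≤4 t₁ t₂ t₃ x s t) (walk₂≤4 t₁ t₂ t₃ x s′ t′)
            (trans (sym (nb₂ s t)) (trans e (nb₂ s′ t′)))))

-- Edge cuts of rings

leftTerm rightTerm : (w w′ : Vec Bool 10) → Fin 10 → Port → ℕ
leftTerm w w′ x (inn _) = 0
leftTerm w w′ x (lft y) = 𝟙 (lookup w x xor lookup w′ y)
leftTerm w w′ x (rgt _) = 0
rightTerm w w′ x (inn _) = 0
rightTerm w w′ x (lft _) = 0
rightTerm w w′ x (rgt y) = 𝟙 (lookup w x xor lookup w′ y)

-- The left side is what a sum over all slots of a block reduces to when only slot 0 of the vertices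
-- 0 and 1, or of 8 and 9, contributes.
two-ports : ∀ {a b a′ b′} → a ≡ a′ → b ≡ b′ → a + 0 + (b + 0 + 0) ≡ a′ + b′
two-ports {a} {b} refl refl = cong₂ _+_ (+-identityʳ a) (trans (+-identityʳ (b + 0)) (+-identityʳ b))

sum-rightTerm : ∀ t w w′ → ∑[ x < 10 ] ∑[ c < 3 ] rightTerm w w′ x (port t x c) ≡ junction w w′
sum-rightTerm t w w′ = go t
  where
  a b : ℕ
  a = 𝟙 (lookup w 8F xor lookup w′ 0F)
  b = 𝟙 (lookup w 9F xor lookup w′ 1F)
  go : ∀ t → ∑[ x < 10 ] ∑[ c < 3 ] rightTerm w w′ x (port t x c) ≡ junction w w′
  go false = two-ports {a} {b} refl refl
  go true  = two-ports {a} {b} refl refl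

sum-leftTerm : ∀ t w w′ → ∑[ x < 10 ] ∑[ c < 3 ] leftTerm w w′ x (port t x c) ≡ junction w′ w
sum-leftTerm t w w′ = go t
  where
  a b : ℕ
  a = 𝟙 (lookup w 0F xor lookup w′ 8F)
  b = 𝟙 (lookup w 1F xor lookup w′ 9F)
  flip : ∀ x y → 𝟙 (lookup w x xor lookup w′ y) ≡ 𝟙 (lookup w′ y xor lookup w x)
  flip x y = cong 𝟙 (Bool.xor-comm (lookup w x) (lookup w′ y))
  go : ∀ t → ∑[ x < 10 ] ∑[ c < 3 ] leftTerm w w′ x (port t x c) ≡ junction w′ w
  go false = two-ports {a} {b} (flip 0F 8F) (flip 1F 9F)
  go true  = two-ports {a} {b} (flip 0F 8F) (flip 1F 9F)

sum-+³ : ∀ {n} (f g h : Fin n → ℕ) → ∑[ i < n ] (f i + (g i + h i)) ≡ sum f + (sum g + sum h)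
sum-+³ f g h = trans (∑-distrib-+ f (λ i → g i + h i)) (cong (sum f +_) (∑-distrib-+ g h))

sum²-+³ : ∀ {n k} (f g h : Fin n → Fin k → ℕ) →
  ∑[ i < n ] ∑[ j < k ] (f i j + (g i j + h i j))
    ≡ ∑[ i < n ] ∑[ j < k ] f i j + (∑[ i < n ] ∑[ j < k ] g i j + ∑[ i < n ] ∑[ j < k ] h i j)
sum²-+³ f g h = trans (sum-cong λ i → sum-+³ (f i) (g i) (h i))
  (sum-+³ (λ i → sum (f i)) (λ i → sum (g i)) (λ i → sum (h i)))

junction-cong : ∀ {w₁ w₁′ w₂ w₂′} → lookup w₁ 8F ≡ lookup w₂ 8F → lookup w₁ 9F ≡ lookup w₂ 9F →
  lookup w₁′ 0F ≡ lookup w₂′ 0F → lookup w₁′ 1F ≡ lookup w₂′ 1F → junction w₁ w₁′ ≡ junction w₂ w₂′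
junction-cong p q r s = cong₂ (λ a b → 𝟙 a + 𝟙 b) (cong₂ _xor_ p r) (cong₂ _xor_ q s)

-- Two blocks with value at least 4 would already sum to 8.
concentrated : ∀ {m} (f : Fin (suc m) → ℕ) → sum f < 8 → ∃[ b₀ ] ∀ b → b ≢ b₀ → f b < 4
concentrated f Σf<8 with any? (λ b → 4 ≤? f b)
... | no  none       = zero , λ b _ → ≰⇒> λ h → none (b , h)
... | yes (b₀ , f≥4) = b₀ , λ b b≢b₀ → ≰⇒> λ h →
  <⇒≱ Σf<8 (≤-trans (+-mono-≤ h f≥4) (two-terms≤sum f b≢b₀))

-- Go round the ring from `b₀`: the value can change only on entering or leaving `b₀`, and every
-- departure from it starts again at `next b₀`.
constant-off : ∀ {m} {A : Set} (f : Fin (suc m) → A) b₀ →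
  (∀ b → b ≢ b₀ → next b ≢ b₀ → f (next b) ≡ f b) → ∀ b → b ≢ b₀ → f b ≡ f (next b₀)
constant-off f b₀ link b b≢b₀ with next-transitive b₀ b
... | k , refl = Sum.fromInj₂ (λ e → contradiction e b≢b₀) (along k)
  where
  along : ∀ k → iter next k b₀ ≡ b₀ ⊎ f (iter next k b₀) ≡ f (next b₀)
  along zero    = inj₁ refl
  along (suc k) with next (iter next k b₀) ≟ b₀ | iter next k b₀ ≟ b₀ | along k
  ... | yes e  | _     | _      = inj₁ e
  ... | no _   | yes e | _      = inj₂ (cong (f ∘ next) e)
  ... | no _   | no ne | inj₁ e = contradiction e ne
  ... | no ne′ | no ne | inj₂ v = inj₂ (trans (link _ ne ne′) v)

module Cut {m : ℕ} (4≤m : 4 ≤ m) (τ : Fin (suc m) → Kind) where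
  open Ring 4≤m τ

  module _ (S : V → Bool) where

    colours : Fin (suc m) → Vec Bool 10
    colours b = tabulate λ x → S (at b x)

    colours-lookup : ∀ b x → lookup (colours b) x ≡ S (at b x)
    colours-lookup b x = lookup∘tabulate (λ x → S (at b x)) x

    -- `C b` charges to block `b` its inner cut edges and those of the junction on its right, all
    -- counted twice.
    J I C : Fin (suc m) → ℕ
    J b = junction (colours b) (colours (next b))
    I b = inner (τ b) (colours b)
    C b = I b + 2 * J b

    -- Each block sees the junctions on both sides; rotating the sum of the left ones makes every
    -- junction count twice at the block on its left.
    boundary-blocks : boundary S ≡ sum C
    boundary-blocks = begin
      boundary S
        ≡⟨ sum-combine (suc m) (λ v → ∑[ c < 3 ] 𝟙 (S v xor S (nb v c))) ⟩
      ∑[ b < suc m ] ∑[ x < 10 ] ∑[ c < 3 ] 𝟙 (S (at b x) xor S (nb (at b x) c))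
        ≡⟨ sum-cong blockwise ⟩
      ∑[ b < suc m ] (I b + (J (prev b) + J b))
        ≡⟨ sum-+³ I (J ∘ prev) J ⟩
      sum I + (sum (J ∘ prev) + sum J)
        ≡⟨ cong (λ s → sum I + (s + sum J))
             (trans (sym (sum-next (J ∘ prev))) (sum-cong λ b → cong J (prev-next b))) ⟩
      sum I + (sum J + sum J)
        ≡⟨ cong (sum I +_) (trans (sym (∑-distrib-+ J J))
             (sum-cong λ b → cong (J b +_) (sym (+-identityʳ (J b))))) ⟩
      sum I + ∑[ b < suc m ] (2 * J b)
        ≡⟨ ∑-distrib-+ I (λ b → 2 * J b) ⟨
      sum C ∎
      where
      open ≡-Reasoning
      term : ∀ b x p → 𝟙 (S (at b x) xor S (place b p)) ≡
        innerTerm (colours b) x p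
          + (leftTerm (colours b) (colours (prev b)) x p + rightTerm (colours b) (colours (next b)) x p)
      term b x (inn y) = trans
        (cong 𝟙 (sym (cong₂ _xor_ (colours-lookup b x) (colours-lookup b y)))) (sym (+-identityʳ _))
      term b x (lft y) = trans
        (cong 𝟙 (sym (cong₂ _xor_ (colours-lookup b x) (colours-lookup (prev b) y)))) (sym (+-identityʳ _))
      term b x (rgt y) = cong 𝟙 (sym (cong₂ _xor_ (colours-lookup b x) (colours-lookup (next b) y)))
      blockwise : ∀ b → ∑[ x < 10 ] ∑[ c < 3 ] 𝟙 (S (at b x) xor S (nb (at b x) c)) ≡ I b + (J (prev b) + J b)
      blockwise b = begin
        ∑[ x < 10 ] ∑[ c < 3 ] 𝟙 (S (at b x) xor S (nb (at b x) c))
          ≡⟨ sum-cong {10} (λ x → sum-cong {3} λ c →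
               trans (cong (λ v → 𝟙 (S (at b x) xor S v)) (nb-at b x c)) (term b x (port (τ b) x c))) ⟩
        ∑[ x < 10 ] ∑[ c < 3 ] (i x c + (l x c + r x c))
          ≡⟨ sum²-+³ i l r ⟩
        I b + (∑[ x < 10 ] sum (l x) + ∑[ x < 10 ] sum (r x))
          ≡⟨ cong (I b +_) (cong₂ _+_
               (trans (sum-leftTerm (τ b) (colours b) (colours (prev b)))
                      (cong (λ b′ → junction (colours (prev b)) (colours b′)) (sym (next-prev b))))
               (sum-rightTerm (τ b) (colours b) (colours (next b)))) ⟩
        I b + (J (prev b) + J b) ∎
        where
        i l r : Fin 10 → Fin 3 → ℕ
        i x c = innerTerm (colours b) x (port (τ b) x c)
        l x c = leftTerm (colours b) (colours (prev b)) x (port (τ b) x c)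
        r x c = rightTerm (colours b) (colours (next b)) x (port (τ b) x c)

    -- At most one block `b₀` has charge 4 or more. Every other block is constant and agrees with
    -- its successor unless that is `b₀`, so the ring outside `b₀` has one colour `c`, and
    -- `inner-exceptional` applies to `b₀`.
    almostConstant : sum C < 8 → AlmostConstant S
    almostConstant ΣC<8 = c , finish
      (Sum.fromInj₂ (λ h → contradiction h (<⇒≱ cost<8)) (inner-exceptional (τ b₀) c (colours b₀)))
      where
      b₀ : Fin (suc m)
      b₀ = proj₁ (concentrated C ΣC<8)
      small : ∀ b → b ≢ b₀ → C b < 4
      small = proj₂ (concentrated C ΣC<8)
      value : Fin (suc m) → Bool
      value b = lookup (colours b) 0F
      c : Bool
      c = value (next b₀)
      constant : ∀ b → b ≢ b₀ → ∀ x → lookup (colours b) x ≡ value b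
      constant b b≢b₀ = Sum.fromInj₂
        (λ h → contradiction (≤-trans h (m≤m+n (I b) (2 * J b))) (<⇒≱ (small b b≢b₀)))
        (inner-nonconstant (τ b) (colours b))
      link : ∀ b → b ≢ b₀ → next b ≢ b₀ → value (next b) ≡ value b
      link b b≢ nb≢ = agree (value b) (value (next b)) (≤-<-trans
        (m≤n+m (2 * junction (replicate 10 (value b)) (replicate 10 (value (next b)))) (I b))
        (subst (λ j → I b + 2 * j < 4)
          (junction-cong {colours b} {colours (next b)} {replicate 10 (value b)} {replicate 10 (value (next b))}
            (constant b b≢ 8F) (constant b b≢ 9F) refl (constant (next b) nb≢ 1F))
          (small b b≢)))
        where
        -- Different constants disagree on both junction edges, which costs 2 * 2.
        agree : ∀ a b → 2 * junction (replicate 10 a) (replicate 10 b) < 4 → b ≡ a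
        agree false false _ = refl
        agree true  true  _ = refl
        agree false true  (s≤s (s≤s (s≤s (s≤s ()))))
        agree true  false (s≤s (s≤s (s≤s (s≤s ()))))
      elsewhere : ∀ b → b ≢ b₀ → ∀ x → lookup (colours b) x ≡ c
      elsewhere b b≢ x = trans (constant b b≢ x) (constant-off value b₀ link b b≢)
      -- The left junction of `b₀` is charged to `prev b₀`, a different block, so the cost is at
      -- most the sum of two terms of `C`.
      cost<8 : cost (τ b₀) c (colours b₀) < 8
      cost<8 = ≤-<-trans (≤-trans
        (+-mono-≤ (≤-reflexive right) (≤-trans (≤-reflexive left) (m≤n+m (2 * J (prev b₀)) (I (prev b₀)))))
        (two-terms≤sum C (≢-sym (prev≢ b₀)))) ΣC<8
        where
        right : I b₀ + 2 * junction (colours b₀) (replicate 10 c) ≡ C b₀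
        right = cong (λ j → I b₀ + 2 * j)
          (junction-cong {colours b₀} {replicate 10 c} {colours b₀} {colours (next b₀)}
            refl refl refl (sym (elsewhere (next b₀) (next≢ b₀) 1F)))
        left : 2 * junction (replicate 10 c) (colours b₀) ≡ 2 * J (prev b₀)
        left = cong (2 *_) (trans
          (junction-cong {replicate 10 c} {colours b₀} {colours (prev b₀)} {colours b₀}
            (sym (elsewhere (prev b₀) (prev≢ b₀) 8F)) (sym (elsewhere (prev b₀) (prev≢ b₀) 9F)) refl refl)
          (cong (λ b → junction (colours (prev b₀)) (colours b)) (sym (next-prev b₀))))
      finish : ∃[ x₀ ] (∀ x → x ≡ x₀ ⊎ lookup (colours b₀) x ≡ c) → ∃[ w ] ∀ v → v ≡ w ⊎ S v ≡ c
      finish (x₀ , h) = at b₀ x₀ , everywhere spread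
        where
        spread : ∀ b x → at b x ≡ at b₀ x₀ ⊎ S (at b x) ≡ c
        spread b x = Sum.[ (λ { refl → Sum.map (cong (at b)) (trans (sym (colours-lookup b x))) (h x) })
                         , (λ b≢ → inj₂ (trans (sym (colours-lookup b x)) (elsewhere b b≢ x))) ]′
                     (toSum (b ≟ b₀))

  boundary≥8 : ∀ S → 8 ≤ boundary S ⊎ AlmostConstant S
  boundary≥8 S = Sum.map (λ h → ≤-trans h (≤-reflexive (sym (boundary-blocks S)))) (almostConstant S)
    (≤-<-connex 8 (sum (C S)))

-- Coverage by three perfect matchings

-- An inner edge chosen at `x` must be chosen at its other end too; a junction edge leaves the block
-- and imposes no local condition.
Answered : Kind → Vec (Fin 3) 10 → Fin 10 → Port → Set
Answered t m x (inn y) = lookup m y ≡ slotTo t y x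
Answered t m x (lft _) = ⊤
Answered t m x (rgt _) = ⊤

answered? : ∀ t m x p → Dec (Answered t m x p)
answered? t m x (inn y) = lookup m y ≟ slotTo t y x
answered? t m x (lft _) = yes tt
answered? t m x (rgt _) = yes tt

-- A perfect matching is recorded by the slot it uses at each vertex.
LocalMatching : Kind → Vec (Fin 3) 10 → Set
LocalMatching t m = ∀ x → Answered t m x (port t x (lookup m x))

localMatching? : ∀ t m → Dec (LocalMatching t m)
localMatching? t m = all? λ x → answered? t m x (port t x (lookup m x))

vecs : ∀ n → List (Vec (Fin 3) n)
vecs zero    = [] ∷ []
vecs (suc n) = cartesianProductWith _∷_ (allFin 3) (vecs n)

∈-vecs : ∀ {n} (v : Vec (Fin 3) n) → v ∈ vecs n
∈-vecs []      = here refl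
∈-vecs (c ∷ v) = ∈-cartesianProductWith⁺ _∷_ (∈-allFin c) (∈-vecs v)

-- Filtering before triples are formed keeps the exhaustive check of `bounds` small.
localMatchings : Kind → List (Vec (Fin 3) 10)
localMatchings t = filter (localMatching? t) (vecs 10)

coverage : (m₁ m₂ m₃ : Vec (Fin 3) 10) → ℕ
coverage m₁ m₂ m₃ = ∑[ x < 10 ] covered (lookup m₁ x) (lookup m₂ x) (lookup m₃ x)

-- The arguments count the matchings using only the first, only the second, and both edges of a
-- junction. The values are a solution of the linear inequalities CovBound.
charge : ℕ → ℕ → ℕ → ℕ
charge (suc _) (suc _) z = 2 * z
charge 0 0 1 = 3
charge _ _ _ = 1

uses : Vec (Fin 3) 10 → Fin 10 → Bool
uses m x = does (0F ≟ lookup m x)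

-- In a 3-edge-colouring it is 0 when the two junction edges have different colours, which suits
-- plain blocks, and 3 when they have the same colour, which suits twisted ones.
ψ : (a₁ b₁ a₂ b₂ a₃ b₃ : Bool) → ℕ
ψ a₁ b₁ a₂ b₂ a₃ b₃ =
  charge (𝟙 (a₁ ∧ not b₁) + 𝟙 (a₂ ∧ not b₂) + 𝟙 (a₃ ∧ not b₃))
         (𝟙 (not a₁ ∧ b₁) + 𝟙 (not a₂ ∧ b₂) + 𝟙 (not a₃ ∧ b₃))
         (𝟙 (a₁ ∧ b₁) + 𝟙 (a₂ ∧ b₂) + 𝟙 (a₃ ∧ b₃))

ψAt : (x y : Fin 10) (m₁ m₂ m₃ : Vec (Fin 3) 10) → ℕ
ψAt x y m₁ m₂ m₃ = ψ (uses m₁ x) (uses m₁ y) (uses m₂ x) (uses m₂ y) (uses m₃ x) (uses m₃ y)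

ψL ψR : (m₁ m₂ m₃ : Vec (Fin 3) 10) → ℕ
ψL = ψAt 0F 1F
ψR = ψAt 8F 9F

-- The deficit of a block is 30 minus its coverage. A plain block has deficit at least the charges
-- of its junctions, a twisted one at least 6 minus these charges. Both are written without
-- subtraction.
CovBound : Kind → (m₁ m₂ m₃ : Vec (Fin 3) 10) → Set
CovBound false m₁ m₂ m₃ = coverage m₁ m₂ m₃ + (ψL m₁ m₂ m₃ + ψR m₁ m₂ m₃) ≤ 30
CovBound true  m₁ m₂ m₃ = coverage m₁ m₂ m₃ + 6 ≤ 30 + (ψL m₁ m₂ m₃ + ψR m₁ m₂ m₃)

covBound? : ∀ t m₁ m₂ m₃ → Dec (CovBound t m₁ m₂ m₃)
covBound? false m₁ m₂ m₃ = coverage m₁ m₂ m₃ + (ψL m₁ m₂ m₃ + ψR m₁ m₂ m₃) ≤? 30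
covBound? true  m₁ m₂ m₃ = coverage m₁ m₂ m₃ + 6 ≤? 30 + (ψL m₁ m₂ m₃ + ψR m₁ m₂ m₃)

allTriples? : ∀ {A : Set} {P : A → A → A → Set} → (∀ x y z → Dec (P x y z)) → (l : List A) →
  Dec (All (λ x → All (λ y → All (P x y) l) l) l)
allTriples? P? l = All.all? (λ x → All.all? (λ y → All.all? (P? x y) l) l) l

abstract
  bounds : ∀ t → let l = localMatchings t in All (λ m₁ → All (λ m₂ → All (CovBound t m₁ m₂) l) l) l
  bounds false = decided (allTriples? (covBound? false) (localMatchings false)) refl
  bounds true = decided (allTriples? (covBound? true) (localMatchings true)) refl

localBound : ∀ t m₁ m₂ m₃ → LocalMatching t m₁ → LocalMatching t m₂ → LocalMatching t m₃ → CovBound t m₁ m₂ m₃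
localBound t m₁ m₂ m₃ h₁ h₂ h₃ = All.lookup (All.lookup (All.lookup (bounds t) (mem h₁)) (mem h₂)) (mem h₃)
  where
  mem : ∀ {m} → LocalMatching t m → m ∈ localMatchings t
  mem {m} h = ∈-filter⁺ (localMatching? t) (∈-vecs m) h

-- Three matchings that look alike at every junction: the first uses only its first edge, the second
-- only its second edge, the third neither.
standard : Kind → Fin 3 → Vec (Fin 3) 10
standard false 0F = 0F ∷ 1F ∷ 0F ∷ 1F ∷ 1F ∷ 2F ∷ 2F ∷ 1F ∷ 0F ∷ 2F ∷ []
standard false 1F = 1F ∷ 0F ∷ 1F ∷ 0F ∷ 0F ∷ 1F ∷ 1F ∷ 2F ∷ 2F ∷ 0F ∷ []
standard false 2F = 2F ∷ 2F ∷ 2F ∷ 2F ∷ 2F ∷ 0F ∷ 0F ∷ 0F ∷ 1F ∷ 1F ∷ []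
standard true  0F = 0F ∷ 1F ∷ 2F ∷ 1F ∷ 2F ∷ 0F ∷ 2F ∷ 1F ∷ 0F ∷ 1F ∷ []
standard true  1F = 1F ∷ 0F ∷ 0F ∷ 2F ∷ 2F ∷ 2F ∷ 0F ∷ 1F ∷ 1F ∷ 0F ∷ []
standard true  2F = 1F ∷ 1F ∷ 0F ∷ 1F ∷ 1F ∷ 1F ∷ 1F ∷ 2F ∷ 2F ∷ 2F ∷ []

-- As in `Returns`, a junction edge must be answered whichever kind the adjacent block has; this
-- lets blocks be combined freely.
Reciprocated : Fin 3 → Kind → Fin 10 → Port → Set
Reciprocated r t x (inn y) = lookup (standard t r) y ≡ slotTo t y x
Reciprocated r t x (lft y) = ∀ t′ → lookup (standard t′ r) y ≡ 0F
Reciprocated r t x (rgt y) = ∀ t′ → lookup (standard t′ r) y ≡ 0F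

reciprocated? : ∀ r t x p → Dec (Reciprocated r t x p)
reciprocated? r t x (inn y) = lookup (standard t r) y ≟ slotTo t y x
reciprocated? r t x (lft y) = allKinds? λ t′ → lookup (standard t′ r) y ≟ 0F
reciprocated? r t x (rgt y) = allKinds? λ t′ → lookup (standard t′ r) y ≟ 0F

abstract
  reciprocated : ∀ r t x → Reciprocated r t x (port t x (lookup (standard t r) x))
  reciprocated = decided (all? λ r → allKinds? λ t → all? λ x →
    reciprocated? r t x (port t x (lookup (standard t r) x))) refl

-- On a plain block the three matchings are disjoint and cover everything; on a twisted block the
-- deficit is 6, the least possible with charge 0 at both junctions.
standard-coverage : ∀ t → coverage (standard t 0F) (standard t 1F) (standard t 2F) + 6 * 𝟙 t ≡ 30
standard-coverage false = refl
standard-coverage true  = refl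

rightPort₀ : ∀ t → port t 8F 0F ≡ rgt 0F
rightPort₀ false = refl
rightPort₀ true  = refl

rightPort₁ : ∀ t → port t 9F 0F ≡ rgt 1F
rightPort₁ false = refl
rightPort₁ true  = refl

ψ-cong : ∀ {a₁ b₁ a₂ b₂ a₃ b₃ a₁′ b₁′ a₂′ b₂′ a₃′ b₃′} →
  a₁ ≡ a₁′ → b₁ ≡ b₁′ → a₂ ≡ a₂′ → b₂ ≡ b₂′ → a₃ ≡ a₃′ → b₃ ≡ b₃′ →
  ψ a₁ b₁ a₂ b₂ a₃ b₃ ≡ ψ a₁′ b₁′ a₂′ b₂′ a₃′ b₃′
ψ-cong refl refl refl refl refl refl = refl

-- A junction at a twisted block has a plain block on its other side, so its charge cancels.
discharge : ∀ {m} (τ : Fin (suc m) → Bool) → (∀ b → τ b ≡ true → τ (next b) ≡ false) →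
  (K L : Fin (suc m) → ℕ) →
  (∀ b → τ b ≡ false → K b + (L b + L (next b)) ≤ 30) →
  (∀ b → τ b ≡ true → K b + 6 ≤ 30 + (L b + L (next b))) →
  sum K + 6 * sum (𝟙 ∘ τ) ≤ suc m * 30
discharge {m} τ isolated K L plain twisted = +-cancelʳ-≤ (sum A + sum B) _ _ (begin
  sum K + 6 * sum (𝟙 ∘ τ) + (sum A + sum B)
    ≡⟨ cong (_+ (sum A + sum B)) (cong (sum K +_) (*-distribˡ-sum 6 (𝟙 ∘ τ))) ⟩
  sum K + sum Q + (sum A + sum B)
    ≡⟨ cong₂ (λ a b → sum K + sum Q + (a + b)) (sym (sum-next A))
         (trans (sum-cong λ b → cong B (sym (prev-next b))) (sum-next (B ∘ prev))) ⟩
  sum K + sum Q + (sum (A ∘ next) + sum (B ∘ prev))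
    ≡⟨ cong₂ _+_ (∑-distrib-+ K Q) (∑-distrib-+ (A ∘ next) (B ∘ prev)) ⟨
  sum (λ b → K b + Q b) + sum (λ b → A (next b) + B (prev b))
    ≡⟨ ∑-distrib-+ (λ b → K b + Q b) (λ b → A (next b) + B (prev b)) ⟨
  sum (λ b → K b + Q b + (A (next b) + B (prev b)))
    ≤⟨ sum-mono (λ b → local b (τ b) refl) ⟩
  sum (λ b → 30 + (A b + B b))
    ≡⟨ ∑-distrib-+ (λ b → 30) (λ b → A b + B b) ⟩
  sum {suc m} (λ b → 30) + sum (λ b → A b + B b)
    ≡⟨ cong₂ _+_ (sum-const (suc m) 30) (∑-distrib-+ A B) ⟩
  suc m * 30 + (sum A + sum B) ∎)
  where
  open ≤-Reasoning
  only : Bool → ℕ → ℕ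
  only t k = if t then k else 0
  only≤ : ∀ t k → only t k ≤ k
  only≤ false k = z≤n
  only≤ true  k = ≤-refl
  A B Q : Fin (suc m) → ℕ
  A b = only (τ b) (L b)
  B b = only (τ b) (L (next b))
  Q b = 6 * 𝟙 (τ b)
  local : ∀ b t → τ b ≡ t → K b + 6 * 𝟙 (τ b) + (A (next b) + B (prev b)) ≤ 30 + (A b + B b)
  local b false τb = begin
    K b + 6 * 𝟙 (τ b) + (A (next b) + B (prev b))
      ≡⟨ cong (λ t → K b + 6 * 𝟙 t + (A (next b) + B (prev b))) τb ⟩
    K b + 0 + (A (next b) + B (prev b))
      ≡⟨ cong (_+ (A (next b) + B (prev b))) (+-identityʳ (K b)) ⟩
    K b + (A (next b) + B (prev b))
      ≤⟨ +-monoʳ-≤ (K b) (+-mono-≤ (only≤ (τ (next b)) (L (next b)))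
           (≤-trans (only≤ (τ (prev b)) (L (next (prev b)))) (≤-reflexive (cong L (next-prev b))))) ⟩
    K b + (L (next b) + L b)
      ≡⟨ cong (K b +_) (+-comm (L (next b)) (L b)) ⟩
    K b + (L b + L (next b))
      ≤⟨ plain b τb ⟩
    30
      ≤⟨ m≤m+n 30 (A b + B b) ⟩
    30 + (A b + B b) ∎
  -- Both neighbours of a twisted block are plain and take nothing from it.
  local b true τb = begin
    K b + 6 * 𝟙 (τ b) + (A (next b) + B (prev b))
      ≡⟨ cong₂ (λ t s → K b + 6 * 𝟙 t + s) τb
           (cong₂ (λ t s → only t (L (next b)) + only s (L (next (prev b))))
             (isolated b τb) (before (τ (prev b)) refl)) ⟩
    K b + 6 + 0
      ≡⟨ +-identityʳ (K b + 6) ⟩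
    K b + 6
      ≤⟨ twisted b τb ⟩
    30 + (L b + L (next b))
      ≡⟨ cong (λ t → 30 + (only t (L b) + only t (L (next b)))) τb ⟨
    30 + (A b + B b) ∎
    where
    before : ∀ t → τ (prev b) ≡ t → τ (prev b) ≡ false
    before false e = e
    before true  e = contradiction
      (trans (sym τb) (trans (cong τ (sym (next-prev b))) (isolated (prev b) e))) λ ()

-- Perfect matchings of a ring

module Cover {m : ℕ} (4≤m : 4 ≤ m) (τ : Fin (suc m) → Kind)
  (isolated : ∀ b → τ b ≡ true → τ (next b) ≡ false) where
  open Ring 4≤m τ

  module _ {M : Rel (suc m * 10)} (perfect : PerfectMatching graph M) where

    μ : V → Fin 3
    μ = proj₁ (slots M perfect)

    restriction : Fin (suc m) → Vec (Fin 3) 10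
    restriction b = tabulate λ x → μ (at b x)

    restriction-lookup : ∀ b x → lookup (restriction b) x ≡ μ (at b x)
    restriction-lookup b x = lookup∘tabulate (λ x → μ (at b x)) x

    private
      across : ∀ v c d → nb (nb v c) d ≡ v → does (c ≟ μ v) ≡ does (d ≟ μ (nb v c))
      across = slots-across (proj₁ perfect) (proj₂ (slots M perfect))

    localMatching : ∀ b → LocalMatching (τ b) (restriction b)
    localMatching b x = subst (λ c → Answered (τ b) (restriction b) x (port (τ b) x c))
      (sym (restriction-lookup b x))
      (answer (port (τ b) x c) (nb-at b x c) chosen)
      where
      c d : Fin 3
      c = μ (at b x)
      d = backSlot (τ b) x (port (τ b) x c)
      chosen : does (d ≟ μ (nb (at b x) c)) ≡ true
      chosen = trans (sym (across (at b x) c d (nb-back b x c))) (dec-true (c ≟ c) refl)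
      answer : ∀ p → nb (at b x) c ≡ place b p → does (backSlot (τ b) x p ≟ μ (nb (at b x) c)) ≡ true →
        Answered (τ b) (restriction b) x p
      answer (inn y) e h = trans (restriction-lookup b y)
        (trans (cong μ (sym e)) (sym (decided (slotTo (τ b) y x ≟ μ (nb (at b x) c)) h)))
      answer (lft y) e h = tt
      answer (rgt y) e h = tt

    -- A junction edge has slot 0 at both ends, so the two blocks agree on its use. Hence both
    -- compute the same charge for their common junction.
    uses-across : ∀ b x y → port (τ b) x 0F ≡ rgt y → uses (restriction b) x ≡ uses (restriction (next b)) y
    uses-across b x y e = begin
      does (0F ≟ lookup (restriction b) x)        ≡⟨ cong (λ c → does (0F ≟ c)) (restriction-lookup b x) ⟩
      does (0F ≟ μ (at b x))                      ≡⟨ across (at b x) 0F 0F back ⟩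
      does (0F ≟ μ (nb (at b x) 0F))              ≡⟨ cong (λ v → does (0F ≟ μ v)) forth ⟩
      does (0F ≟ μ (at (next b) y))               ≡⟨ cong (λ c → does (0F ≟ c)) (restriction-lookup (next b) y) ⟨
      does (0F ≟ lookup (restriction (next b)) y) ∎
      where
      open ≡-Reasoning
      forth : nb (at b x) 0F ≡ at (next b) y
      forth = trans (nb-at b x 0F) (cong (place b) e)
      back : nb (nb (at b x) 0F) 0F ≡ at b x
      back = trans (cong (λ p → nb (nb (at b x) 0F) (backSlot (τ b) x p)) (sym e)) (nb-back b x 0F)

  -- Twice the number of covered edges is the sum of the block coverages. The right charge of `b` is
  -- the left charge of `next b`, so a single function `L` on junctions feeds `discharge`.
  union-bound : ∀ M₁ M₂ M₃ → PerfectMatching graph M₁ → PerfectMatching graph M₂ → PerfectMatching graph M₃ →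
    2 * countEdges (union3 graph M₁ M₂ M₃) + 6 * sum (𝟙 ∘ τ) ≤ suc m * 30
  union-bound M₁ M₂ M₃ P₁ P₂ P₃ = begin
    2 * countEdges (union3 graph M₁ M₂ M₃) + 6 * sum (𝟙 ∘ τ)
      ≡⟨ cong (_+ 6 * sum (𝟙 ∘ τ)) (trans
           (union-count (proj₁ P₁) (proj₁ P₂) (proj₁ P₃)
             (proj₂ (slots M₁ P₁)) (proj₂ (slots M₂ P₂)) (proj₂ (slots M₃ P₃)))
           (trans (sum-combine (suc m) (λ v → covered (μ P₁ v) (μ P₂ v) (μ P₃ v)))
             (sum-cong λ b → sum-cong {10} λ x → sym (covered-cong
               (restriction-lookup P₁ b x) (restriction-lookup P₂ b x) (restriction-lookup P₃ b x))))) ⟩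
    sum K + 6 * sum (𝟙 ∘ τ)
      ≤⟨ discharge τ isolated K L
           (λ b e → subst (λ r → K b + (L b + r) ≤ 30) (R≡L b) (plain b (τ b) e (local b)))
           (λ b e → subst (λ r → K b + 6 ≤ 30 + (L b + r)) (R≡L b) (twisted b (τ b) e (local b))) ⟩
    suc m * 30 ∎
    where
    open ≤-Reasoning
    r₁ r₂ r₃ : Fin (suc m) → Vec (Fin 3) 10
    r₁ = restriction P₁
    r₂ = restriction P₂
    r₃ = restriction P₃
    K L R : Fin (suc m) → ℕ
    K b = coverage (r₁ b) (r₂ b) (r₃ b)
    L b = ψL (r₁ b) (r₂ b) (r₃ b)
    R b = ψR (r₁ b) (r₂ b) (r₃ b)
    R≡L : ∀ b → R b ≡ L (next b)
    R≡L b = ψ-cong (first P₁) (second P₁) (first P₂) (second P₂) (first P₃) (second P₃)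
      where
      first : ∀ {M} (P : PerfectMatching graph M) → uses (restriction P b) 8F ≡ uses (restriction P (next b)) 0F
      first P = uses-across P b 8F 0F (rightPort₀ (τ b))
      second : ∀ {M} (P : PerfectMatching graph M) → uses (restriction P b) 9F ≡ uses (restriction P (next b)) 1F
      second P = uses-across P b 9F 1F (rightPort₁ (τ b))
    local : ∀ b → CovBound (τ b) (r₁ b) (r₂ b) (r₃ b)
    local b = localBound (τ b) (r₁ b) (r₂ b) (r₃ b) (localMatching P₁ b) (localMatching P₂ b) (localMatching P₃ b)
    -- The kind is generalised to `t` so that `CovBound` can compute.
    plain : ∀ b t → t ≡ false → CovBound t (r₁ b) (r₂ b) (r₃ b) → K b + (L b + R b) ≤ 30
    plain b false refl h = h
    twisted : ∀ b t → t ≡ true → CovBound t (r₁ b) (r₂ b) (r₃ b) → K b + 6 ≤ 30 + (L b + R b)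
    twisted b true refl h = h

  standard-slot : Fin 3 → V → Fin 3
  standard-slot r v = uncurry (λ b x → lookup (standard (τ b) r) x) (remQuot {suc m} 10 v)

  standard-slot-at : ∀ r b x → standard-slot r (at b x) ≡ lookup (standard (τ b) r) x
  standard-slot-at r b x = cong (uncurry λ b x → lookup (standard (τ b) r) x) (remQuot-combine b x)

  standard-mutual : ∀ r v → nb (nb v (standard-slot r v)) (standard-slot r (nb v (standard-slot r v))) ≡ v
  standard-mutual r = everywhere λ b x → subst
    (λ c → nb (nb (at b x) c) (standard-slot r (nb (at b x) c)) ≡ at b x)
    (sym (standard-slot-at r b x))
    (trans (cong (nb (nb (at b x) (slot b x))) (answer b x)) (nb-back b x (slot b x)))
    where
    slot : Fin (suc m) → Fin 10 → Fin 3
    slot b x = lookup (standard (τ b) r) x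
    reply : ∀ b x p → Reciprocated r (τ b) x p → standard-slot r (place b p) ≡ backSlot (τ b) x p
    reply b x (inn y) h = trans (standard-slot-at r b y) h
    reply b x (lft y) h = trans (standard-slot-at r (prev b) y) (h (τ (prev b)))
    reply b x (rgt y) h = trans (standard-slot-at r (next b) y) (h (τ (next b)))
    answer : ∀ b x → standard-slot r (nb (at b x) (slot b x)) ≡ backSlot (τ b) x (port (τ b) x (slot b x))
    answer b x = trans (cong (standard-slot r) (nb-at b x (slot b x)))
      (reply b x (port (τ b) x (slot b x)) (reciprocated r (τ b) x))

  module Standard (r : Fin 3) = Matching (standard-slot r) (standard-mutual r)

  standard-count :
    2 * countEdges (union3 graph (Standard.matching 0F) (Standard.matching 1F) (Standard.matching 2F))
      + 6 * sum (𝟙 ∘ τ) ≡ suc m * 30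
  standard-count = begin
    2 * countEdges (union3 graph (Standard.matching 0F) (Standard.matching 1F) (Standard.matching 2F))
      + 6 * sum (𝟙 ∘ τ)
      ≡⟨ cong₂ _+_ (trans
           (union-count (Standard.edgeSet 0F) (Standard.edgeSet 1F) (Standard.edgeSet 2F)
             (Standard.matching-slots 0F) (Standard.matching-slots 1F) (Standard.matching-slots 2F))
           (trans (sum-combine (suc m) (λ v → covered (standard-slot 0F v) (standard-slot 1F v) (standard-slot 2F v)))
             (sum-cong λ b → sum-cong {10} λ x → covered-cong
               (standard-slot-at 0F b x) (standard-slot-at 1F b x) (standard-slot-at 2F b x))))
           (*-distribˡ-sum 6 (𝟙 ∘ τ)) ⟩
    sum K + sum (λ b → 6 * 𝟙 (τ b))
      ≡⟨ ∑-distrib-+ K (λ b → 6 * 𝟙 (τ b)) ⟨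
    sum (λ b → K b + 6 * 𝟙 (τ b))
      ≡⟨ trans (sum-cong λ b → standard-coverage (τ b)) (sum-const (suc m) 30) ⟩
    suc m * 30 ∎
    where
    open ≡-Reasoning
    K : Fin (suc m) → ℕ
    K b = coverage (standard (τ b) 0F) (standard (τ b) 1F) (standard (τ b) 2F)

-- The construction

-- The twisted blocks are those at the first a even positions.
isTwisted : ℕ → ℕ → Kind
isTwisted zero    _             = false
isTwisted (suc a) 0             = true
isTwisted (suc a) 1             = false
isTwisted (suc a) (suc (suc j)) = isTwisted a j

isTwisted-odd : ∀ a k → isTwisted a (suc (k * 2)) ≡ false
isTwisted-odd zero    k       = refl
isTwisted-odd (suc a) zero    = refl
isTwisted-odd (suc a) (suc k) = isTwisted-odd a k

isTwisted-isolated : ∀ a j → isTwisted a j ≡ true → isTwisted a (suc j) ≡ false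
isTwisted-isolated (suc a) 0             _ = refl
isTwisted-isolated (suc a) (suc (suc j)) h = isTwisted-isolated a j h

count-isTwisted : ∀ a k → a ≤ k → ∑[ b < k * 2 ] 𝟙 (isTwisted a (toℕ b)) ≡ a
count-isTwisted zero    k       _         = sum-zero {k * 2} λ _ → refl
count-isTwisted (suc a) (suc k) (s≤s a≤k) = cong suc (count-isTwisted a k a≤k)

-- The only new case is the passage from the last position to zero: the length is even, so the last
-- position is odd and never twisted.
next-isolated : ∀ a k (b : Fin (suc k * 2)) → isTwisted a (toℕ b) ≡ true → isTwisted a (toℕ (next b)) ≡ false
next-isolated a k b h with toℕ-next b
... | inj₁ e        = trans (cong (isTwisted a) e) (isTwisted-isolated a (toℕ b) h)
... | inj₂ (_ , e)  = contradiction (trans (sym h) (trans (cong (isTwisted a) e) (isTwisted-odd a k))) λ ()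

module FiveCycle {m : ℕ} (4≤m : 4 ≤ m) (τ : Fin (suc m) → Kind) where
  open Ring 4≤m τ

  hasGirth-5 : ∀ b → τ b ≡ false → HasGirth graph 5
  hasGirth-5 b e =
    ( List.map (at b) pentagon
    , ( Unique.map⁺ (λ {x} {y} → proj₂ ∘ at-injective b x b y) (decided (unique? _≟_ pentagon) refl)
      , s≤s (s≤s (s≤s z≤n))
      , edge 3F 1F refl , edge 4F 2F refl , edge 9F 2F refl , edge 6F 1F refl , edge 7F 0F refl , tt )
    , refl )
    , girth≥5 (everywhere λ b x → proj₁ (girth-local b x)) (everywhere λ b x → proj₂ (girth-local b x))
    where
    -- A 5-cycle of inner edges of a plain block.
    pentagon : List (Fin 10)
    pentagon = 3F ∷ 4F ∷ 9F ∷ 6F ∷ 7F ∷ []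
    edge : ∀ x c {y} → port false x c ≡ inn y → adjacent (at b x) (at b y) ≡ true
    edge x c h = subst (λ v → adjacent (at b x) v ≡ true)
      (trans (nb-at b x c) (cong (place b) (trans (cong (λ t → port t x c) e) h)))
      (adjacent-nb (at b x) c)

-- The ring is seen only through its number `l` of blocks and its number `a` of twisted ones, so
-- that `a` can be rewritten and the value of m₃ is pure arithmetic.
record RingGraph (l a : ℕ) : Set where
  field
    G              : Graph
  open Graph G
  field
    vertices       : n ≡ l * 10
    cubic          : Cubic G
    bridgeless     : Bridgeless G
    connected      : CyclicallyConnected G 4
    girth          : HasGirth G 5
    edges          : 2 * countEdges adj ≡ l * 10 * 3
    M₁ M₂ M₃       : Rel n
    perfect₁       : PerfectMatching G M₁
    perfect₂       : PerfectMatching G M₂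
    perfect₃       : PerfectMatching G M₃
    union-attained : 2 * countEdges (union3 G M₁ M₂ M₃) + 6 * a ≡ l * 30
    union-bounded  : ∀ M₁ M₂ M₃ → PerfectMatching G M₁ → PerfectMatching G M₂ → PerfectMatching G M₃ →
                     2 * countEdges (union3 G M₁ M₂ M₃) + 6 * a ≤ l * 30

ringGraph : ∀ {m} → 4 ≤ m → (τ : Fin (suc m) → Kind) → (∀ b → τ b ≡ true → τ (next b) ≡ false) →
  ∀ b → τ b ≡ false → RingGraph (suc m) (sum (𝟙 ∘ τ))
ringGraph 4≤m τ isolated b τb = record
  { G              = Ring.graph 4≤m τ
  ; vertices       = refl
  ; cubic          = Ring.cubic 4≤m τ
  ; bridgeless     = Ring.bridgeless 4≤m τ (Cut.boundary≥8 4≤m τ)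
  ; connected      = Ring.cyclicallyConnected 4≤m τ (Cut.boundary≥8 4≤m τ)
  ; girth          = FiveCycle.hasGirth-5 4≤m τ b τb
  ; edges          = Ring.countEdges-adjacent 4≤m τ
  ; perfect₁       = Standard.perfectMatching 0F
  ; perfect₂       = Standard.perfectMatching 1F
  ; perfect₃       = Standard.perfectMatching 2F
  ; union-attained = standard-count
  ; union-bounded  = union-bound
  }
  where open Cover 4≤m τ isolated

-- Three pairs guarantee the five blocks that `Ring` asks for; position 1 is odd, hence a plain
-- block containing a pentagon.
pairedRing : ∀ k a → a ≤ 3 + k → RingGraph ((3 + k) * 2) a
pairedRing k a a≤ = subst (RingGraph ((3 + k) * 2)) (count-isTwisted a (3 + k) a≤)
  (ringGraph (s≤s (s≤s (s≤s (s≤s z≤n)))) (λ b → isTwisted a (toℕ b))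
    (next-isolated a (2 + k)) 1F (isTwisted-odd a 0))

-- There are 30qt edges, and each of the 10dt twisted blocks leaves three uncovered. So the maximum
-- is 30qt - 30dt = 30pt, a fraction p/q of all edges.
module _ {p d q t : ℕ} (p+d≡q : p + d ≡ q) (R : RingGraph (q * t * 2) (10 * d * t)) where
  open RingGraph R
  open Graph G using (adj)

  private
    edges≡ : countEdges adj ≡ 30 * q * t
    edges≡ = *-cancelˡ-≡ (countEdges adj) (30 * q * t) 2 (trans edges (regroup q t))
      where
      regroup : ∀ q t → q * t * 2 * 10 * 3 ≡ 2 * (30 * q * t)
      regroup = solve-∀

    total : q * t * 2 * 30 ≡ 2 * (30 * p * t) + 6 * (10 * d * t)
    total = trans (cong (λ q → q * t * 2 * 30) (sym p+d≡q)) (expand p d t)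
      where
      expand : ∀ p d t → (p + d) * t * 2 * 30 ≡ 2 * (30 * p * t) + 6 * (10 * d * t)
      expand = solve-∀

    exchange : 30 * p * t * q ≡ p * countEdges adj
    exchange = trans (swap p q t) (cong (p *_) (sym edges≡))
      where
      swap : ∀ p q t → 30 * p * t * q ≡ p * (30 * q * t)
      swap = solve-∀

  m3Equals : M3Equals G p q
  m3Equals =
    ( M₁ , M₂ , M₃ , perfect₁ , perfect₂ , perfect₃
    , trans (cong (_* q) (*-cancelˡ-≡ (countEdges (union3 G M₁ M₂ M₃)) (30 * p * t) 2
        (+-cancelʳ-≡ (6 * (10 * d * t)) _ _ (trans union-attained total)))) exchange ) ,
    λ M₁ M₂ M₃ P₁ P₂ P₃ → ≤-trans
      (*-monoˡ-≤ q (*-cancelˡ-≤ {countEdges (union3 G M₁ M₂ M₃)} {30 * p * t} 2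
        (+-cancelʳ-≤ (6 * (10 * d * t)) _ _
          (≤-trans (union-bounded M₁ M₂ M₃ P₁ P₂ P₃) (≤-reflexive total)))))
      (≤-reflexive exchange)

theorem2 : (p q : ℕ) → 9 * q ≤ 10 * p → p < q →
    (N : ℕ) → Σ Graph λ G → N ≤ Graph.n G × Cubic G × Bridgeless G ×
    CyclicallyConnected G 4 × HasGirth G 5 × M3Equals G p q
theorem2 p q@(suc q′) 9q≤10p p<q N =
  G , N≤n , cubic , bridgeless , connected , girth , m3Equals {p} {d} {q} {t} p+d≡q R
  where
  t d : ℕ
  -- The scale makes the ring long enough and the order at least `N`, without changing the ratio of
  -- twisted blocks to all blocks.
  t = 3 + N
  d = proj₁ (m≤n⇒∃[o]m+o≡n (<⇒≤ p<q))

  p+d≡q : p + d ≡ q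
  p+d≡q = proj₂ (m≤n⇒∃[o]m+o≡n (<⇒≤ p<q))

  -- Here 9/10 enters: the 10dt twisted blocks must fit into the qt even positions.
  10d≤q : 10 * d ≤ q
  10d≤q = +-cancelʳ-≤ (9 * q) (10 * d) q (begin
    10 * d + 9 * q  ≤⟨ +-monoʳ-≤ (10 * d) 9q≤10p ⟩
    10 * d + 10 * p ≡⟨ +-comm (10 * d) (10 * p) ⟩
    10 * p + 10 * d ≡⟨ *-distribˡ-+ 10 p d ⟨
    10 * (p + d)    ≡⟨ cong (10 *_) p+d≡q ⟩
    q + 9 * q       ∎)
    where open ≤-Reasoning

  R : RingGraph (q * t * 2) (10 * d * t)
  -- The argument is chosen so that `3 + (N + q′ * t)` computes to `q * t`.
  R = pairedRing (N + q′ * t) (10 * d * t) (*-monoˡ-≤ t 10d≤q)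
  open RingGraph R

  N≤n : N ≤ Graph.n G
  N≤n = begin
    N              ≤⟨ m≤n+m N 3 ⟩
    t              ≤⟨ m≤m+n t (q′ * t) ⟩
    q * t          ≤⟨ m≤m*n (q * t) 2 ⟩
    q * t * 2      ≤⟨ m≤m*n (q * t * 2) 10 ⟩
    q * t * 2 * 10 ≡⟨ vertices ⟨
    Graph.n G      ∎
    where open ≤-Reasoning
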